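{- For any odd positive integer $n$, we have $$\sum_{k=0}^{\frac{n-1}{2}}q^{k^2}\frac{(q;q^2)_k}{(q^4;q^4)_k}\equiv (-q)^{\frac{1-n^2}{8}}\pmod{\Phi_n(q)^2}.$$
   Context: Here $q$ is an indeterminate. The $q$-shifted factorial is defined by $(a;q)_m=(1-a)(1-aq)\cdots(1-aq^{m-1})$ for integers $m\geq 1$ and $(a;q)_0=1$; thus $(q;q^2)_k=\prod_{j=0}^{k-1}(1-q^{2j+1})$ and $(q^4;q^4)_k=\prod_{j=1}^{k}(1-q^{4j})$. $\Phi_n(q)$ denotes the $n$-th cyclotomic polynomial in $q$. Both sides of the congruence are rational functions of $q$. As is standard, for rational functions $A(q),B(q)\in\mathbb{Q}(q)$ and a polynomial $P(q)$, the congruence $A(q)\equiv B(q)\pmod{P(q)}$ means that $A(q)-B(q)$, written as a fraction of polynomials in lowest terms, has numerator divisible by $P(q)$ (and hence denominator coprime to $P(q)$). For odd $n$ the exponent $(1-n^2)/8$ is an integer. -}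

module Defs where

open import Algebra.Bundles.Raw using (RawRing)
import Algebra.Definitions.RawSemiring as SemiringDefs
open import Data.Bool.Base using (if_then_else_)
open import Data.Fin.Base using (Fin; toℕ)
open import Data.Fin.Properties using (toℕ<n)
open import Data.Integer.Base using (ℤ; +_; -[1+_])
open import Data.List.Base using (List; []; _∷_; map; foldr)
open import Data.List.Relation.Unary.All using (all?)
open import Data.Nat.Base as ℕ using (ℕ; zero; suc)
open import Data.Nat.Divisibility using (_∣?_)
open import Data.Nat.Induction using (<-rec)
open import Data.Product.Base using (_×_; _,_; proj₁)
open import Data.Rational.Base as ℚ using (ℚ; 0ℚ; 1ℚ)
import Data.Rational.Properties as ℚ
open import Data.Sum.Base using (_⊎_; inj₁; inj₂)
import Data.Sum.Base as Sum
open import Data.Vec.Functional using (Vector)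
open import Level using (0ℓ)
open import Relation.Binary.PropositionalEquality
open import Relation.Nullary using (yes; no; does; contradiction)

-- The list a₀ ∷ a₁ ∷ … ∷ [] stands for a₀ + a₁ q + ….  Trailing zeros
-- are allowed, so equality of polynomials is the relation _≈_ below.

ℚ[q] : Set
ℚ[q] = List ℚ

coeff : ℚ[q] → ℕ → ℚ
coeff []      _       = 0ℚ
coeff (a ∷ _) zero    = a
coeff (_ ∷ f) (suc i) = coeff f i

module P where

  infix  4 _≈_
  infix  8 -_
  infixl 7 _*_ _·_
  infixl 6 _+_ _-_

  record _≈_ (f g : ℚ[q]) : Set where
    constructor coeffwise
    field
      coeff≡ : ∀ i → coeff f i ≡ coeff g i

  open _≈_ public

  _+_ : ℚ[q] → ℚ[q] → ℚ[q]
  []      + g       = g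
  (a ∷ f) + []      = a ∷ f
  (a ∷ f) + (b ∷ g) = (a ℚ.+ b) ∷ (f + g)

  _·_ : ℚ → ℚ[q] → ℚ[q]
  a · f = map (a ℚ.*_) f

  _*_ : ℚ[q] → ℚ[q] → ℚ[q]
  []      * g = []
  (a ∷ f) * g = a · g + (0ℚ ∷ f * g)

  -_ : ℚ[q] → ℚ[q]
  - f = map ℚ.-_ f

  _-_ : ℚ[q] → ℚ[q] → ℚ[q]
  f - g = f + - g

  rawRing : RawRing 0ℓ 0ℓ
  rawRing = record
    { _≈_ = _≈_
    ; _+_ = _+_
    ; _*_ = _*_
    ; -_  = -_
    ; 0#  = []
    ; 1#  = 1ℚ ∷ []
    }

  open RawRing rawRing public using (0#; 1#; _≉_)
  open SemiringDefs (RawRing.rawSemiring rawRing) public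
    using (_^_; product; _∣_; Coprime)

  X : ℚ[q]
  X = 0ℚ ∷ 1ℚ ∷ []

  -- The degree of the zero polynomial is taken to be 0.
  degree : ℚ[q] → ℕ
  degree []      = 0
  degree (_ ∷ f) = if does (all? (ℚ._≟ 0ℚ) f) then 0 else suc (degree f)

  -- Long division by g, highest coefficient first; the result is the
  -- quotient and remainder provided that g is monic.  If f = u g + r then
  -- a + q f = q u g + (a + q r), and divStep removes from a + q r its term
  -- of degree equal to that of g.
  divStep : ℚ[q] → ℚ → ℚ[q] × ℚ[q] → ℚ[q] × ℚ[q]
  divStep g a (u , r) = c ∷ u , (a ∷ r) - c · g
    where c = coeff (a ∷ r) (degree g)

  quotRem : ℚ[q] → ℚ[q] → ℚ[q] × ℚ[q]
  quotRem f g = foldr (divStep g) ([] , []) f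

  quot : ℚ[q] → ℚ[q] → ℚ[q]
  quot f g = proj₁ (quotRem f g)

  -- The q-shifted factorial (a;b)ₘ.
  ⟨_⨾_⟩ : ℚ[q] → ℚ[q] → ℕ → ℚ[q]
  ⟨ a ⨾ b ⟩ m = product {m} λ j → 1# - a * b ^ toℕ j

  a*b≡0 : ∀ a b → a ℚ.* b ≡ 0ℚ → a ≡ 0ℚ ⊎ b ≡ 0ℚ
  a*b≡0 a b ab≡0 with a ℚ.≟ 0ℚ
  ... | yes a≡0 = inj₁ a≡0
  ... | no  a≢0 = inj₂ (begin
    b                        ≡⟨ ℚ.*-identityˡ b ⟨
    1ℚ ℚ.* b                 ≡⟨ cong (ℚ._* b) (ℚ.*-inverseˡ a) ⟨
    ((ℚ.1/ a) ℚ.* a) ℚ.* b   ≡⟨ ℚ.*-assoc (ℚ.1/ a) a b ⟩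
    (ℚ.1/ a) ℚ.* (a ℚ.* b)   ≡⟨ cong ((ℚ.1/ a) ℚ.*_) ab≡0 ⟩
    (ℚ.1/ a) ℚ.* 0ℚ          ≡⟨ ℚ.*-zeroʳ (ℚ.1/ a) ⟩
    0ℚ                       ∎)
    where
      open ≡-Reasoning
      instance _ = ℚ.≢-nonZero a≢0

  coeff-+ : ∀ f g i → coeff (f + g) i ≡ coeff f i ℚ.+ coeff g i
  coeff-+ []      g       i       = sym (ℚ.+-identityˡ _)
  coeff-+ (a ∷ f) []      i       = sym (ℚ.+-identityʳ _)
  coeff-+ (a ∷ f) (b ∷ g) zero    = refl
  coeff-+ (a ∷ f) (b ∷ g) (suc i) = coeff-+ f g i

  coeff-· : ∀ a f i → coeff (a · f) i ≡ a ℚ.* coeff f i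
  coeff-· a []      i       = sym (ℚ.*-zeroʳ a)
  coeff-· a (_ ∷ f) zero    = refl
  coeff-· a (_ ∷ f) (suc i) = coeff-· a f i

  coeff-- : ∀ f i → coeff (- f) i ≡ ℚ.- coeff f i
  coeff-- []      i       = refl
  coeff-- (_ ∷ f) zero    = refl
  coeff-- (_ ∷ f) (suc i) = coeff-- f i

  coeff-∷* : ∀ a f g i →
    coeff ((a ∷ f) * g) i ≡ a ℚ.* coeff g i ℚ.+ coeff (0ℚ ∷ f * g) i
  coeff-∷* a f g i = trans (coeff-+ (a · g) _ i)
                           (cong (ℚ._+ coeff (0ℚ ∷ f * g) i) (coeff-· a g i))

  coeff₀-* : ∀ f g → coeff (f * g) 0 ≡ coeff f 0 ℚ.* coeff g 0
  coeff₀-* []      g = sym (ℚ.*-zeroˡ (coeff g 0))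
  coeff₀-* (a ∷ f) g = trans (coeff-∷* a f g 0) (ℚ.+-identityʳ _)

  *-shift : ∀ f b g → b ≡ 0ℚ → ∀ i →
    coeff (f * (b ∷ g)) (suc i) ≡ coeff (f * g) i
  *-shift []      b g b≡0 i = refl
  *-shift (a ∷ f) b g b≡0 i = begin
    coeff ((a ∷ f) * (b ∷ g)) (suc i)
      ≡⟨ coeff-∷* a f (b ∷ g) (suc i) ⟩
    a ℚ.* coeff g i ℚ.+ coeff (f * (b ∷ g)) i
      ≡⟨ cong (a ℚ.* coeff g i ℚ.+_) (tail i) ⟩
    a ℚ.* coeff g i ℚ.+ coeff (0ℚ ∷ f * g) i
      ≡⟨ coeff-∷* a f g i ⟨
    coeff ((a ∷ f) * g) i ∎
    where
    open ≡-Reasoning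
    tail : ∀ i → coeff (f * (b ∷ g)) i ≡ coeff (0ℚ ∷ f * g) i
    tail zero    = trans (coeff₀-* f (b ∷ g))
                     (trans (cong (coeff f 0 ℚ.*_) b≡0) (ℚ.*-zeroʳ (coeff f 0)))
    tail (suc i) = *-shift f b g b≡0 i

  ∷≈0 : ∀ {a f} → a ≡ 0ℚ → f ≈ 0# → (a ∷ f) ≈ 0#
  ∷≈0 a≡0 f≈0 .coeff≡ zero    = a≡0
  ∷≈0 a≡0 f≈0 .coeff≡ (suc i) = f≈0 .coeff≡ i

  f*g≈0 : ∀ f g → f * g ≈ 0# → f ≈ 0# ⊎ g ≈ 0#
  f*g≈0 []      g       fg≈0 = inj₁ (coeffwise λ _ → refl)
  f*g≈0 (a ∷ f) []      fg≈0 = inj₂ (coeffwise λ _ → refl)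
  f*g≈0 (a ∷ f) (b ∷ g) fg≈0 = Sum.[
      (λ a≡0 → Sum.map₁ (∷≈0 a≡0) (f*g≈0 f (b ∷ g) (coeffwise λ i → begin
        coeff (f * (b ∷ g)) i
          ≡⟨ ℚ.+-identityˡ _ ⟨
        0ℚ ℚ.+ coeff (f * (b ∷ g)) i
          ≡⟨ cong (ℚ._+ coeff (f * (b ∷ g)) i)
               (trans (cong (ℚ._* coeff g i) a≡0) (ℚ.*-zeroˡ (coeff g i))) ⟨
        a ℚ.* coeff g i ℚ.+ coeff (f * (b ∷ g)) i
          ≡⟨ coeff-∷* a f (b ∷ g) (suc i) ⟨
        coeff ((a ∷ f) * (b ∷ g)) (suc i)
          ≡⟨ fg≈0 .coeff≡ (suc i) ⟩
        0ℚ ∎)))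
    , (λ b≡0 → Sum.map₂ (∷≈0 b≡0) (f*g≈0 (a ∷ f) g (coeffwise λ i →
        trans (sym (*-shift (a ∷ f) b g b≡0 i)) (fg≈0 .coeff≡ (suc i)))))
    ]′ (a*b≡0 a b (trans (sym (coeff₀-* (a ∷ f) (b ∷ g))) (fg≈0 .coeff≡ 0)))
    where open ≡-Reasoning

  *-≉0 : ∀ {f g} → f ≉ 0# → g ≉ 0# → f * g ≉ 0#
  *-≉0 f≉0 g≉0 fg≈0 = Sum.[ f≉0 , g≉0 ]′ (f*g≈0 _ _ fg≈0)

  product-≉0 : ∀ {m} (f : Vector ℚ[q] m) → (∀ j → f j ≉ 0#) → product f ≉ 0#
  product-≉0 {zero}  f f≉0 1≈0 with () ← 1≈0 .coeff≡ 0
  product-≉0 {suc m} f f≉0 = *-≉0 (f≉0 Fin.zero)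
                                  (product-≉0 (λ j → f (Fin.suc j)) λ j → f≉0 (Fin.suc j))

  ⟨⨾⟩-≉0 : ∀ a b → coeff a 0 ≡ 0ℚ → ∀ m → ⟨ a ⨾ b ⟩ m ≉ 0#
  ⟨⨾⟩-≉0 a b a₀≡0 m = product-≉0 {m} _ λ j 1-ab≈0 →
    contradiction (trans (sym (const (b ^ toℕ j))) (1-ab≈0 .coeff≡ 0)) λ ()
    where
    open ≡-Reasoning
    const : ∀ c → coeff (1# - a * c) 0 ≡ 1ℚ
    const c = begin
      coeff (1# - a * c) 0                    ≡⟨ coeff-+ 1# (- (a * c)) 0 ⟩
      1ℚ ℚ.+ coeff (- (a * c)) 0              ≡⟨ cong (1ℚ ℚ.+_) (coeff-- (a * c) 0) ⟩
      1ℚ ℚ.+ ℚ.- coeff (a * c) 0              ≡⟨ cong (λ x → 1ℚ ℚ.+ ℚ.- x) (coeff₀-* a c) ⟩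
      1ℚ ℚ.+ ℚ.- (coeff a 0 ℚ.* coeff c 0)    ≡⟨ cong (λ x → 1ℚ ℚ.+ ℚ.- (x ℚ.* coeff c 0)) a₀≡0 ⟩
      1ℚ ℚ.+ ℚ.- (0ℚ ℚ.* coeff c 0)           ≡⟨ cong (λ x → 1ℚ ℚ.+ ℚ.- x) (ℚ.*-zeroˡ (coeff c 0)) ⟩
      1ℚ                                      ∎

-- The cyclotomic polynomials, determined for n ≥ 1 by
--   ∏_{d ∣ n} Φ d = qⁿ - 1,
-- that is, Φ n is the quotient of qⁿ - 1 by the (monic) product of all
-- Φ d with d ∣ n and d < n.  The value Φ 0 has no meaning.

Φ : ℕ → ℚ[q]
Φ = <-rec (λ _ → ℚ[q]) λ n Φ< →
  P.quot (P.X P.^ n P.- P.1#)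
         (P.product λ (d : Fin n) →
            if does (toℕ d ∣? n) then Φ< (toℕ<n d) else P.1#)

infix 7 _/_[_]

record ℚ⟨q⟩ : Set where
  constructor _/_[_]
  field
    num   : ℚ[q]
    den   : ℚ[q]
    den≉0 : den P.≉ P.0#

open ℚ⟨q⟩ public

infix  4 _≃_
infix  8 -_
infixl 7 _*_
infixl 6 _+_ _-_

record _≃_ (A B : ℚ⟨q⟩) : Set where
  constructor cross
  field
    cross-≈ : num A P.* den B P.≈ num B P.* den A

_+_ : ℚ⟨q⟩ → ℚ⟨q⟩ → ℚ⟨q⟩
A + B = (num A P.* den B P.+ num B P.* den A) / (den A P.* den B)
        [ P.*-≉0 (den≉0 A) (den≉0 B) ]

_*_ : ℚ⟨q⟩ → ℚ⟨q⟩ → ℚ⟨q⟩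
A * B = (num A P.* num B) / (den A P.* den B) [ P.*-≉0 (den≉0 A) (den≉0 B) ]

-_ : ℚ⟨q⟩ → ℚ⟨q⟩
- A = (P.- num A) / den A [ den≉0 A ]

_-_ : ℚ⟨q⟩ → ℚ⟨q⟩ → ℚ⟨q⟩
A - B = A + - B

fromPoly : ℚ[q] → ℚ⟨q⟩
fromPoly f = f / P.1# [ (λ 1≈0 → contradiction (1≈0 .P.coeff≡ 0) λ ()) ]

q : ℚ⟨q⟩
q = fromPoly P.X

ℚ⟨q⟩-rawRing : RawRing 0ℓ 0ℓ
ℚ⟨q⟩-rawRing = record
  { _≈_ = _≃_
  ; _+_ = _+_
  ; _*_ = _*_
  ; -_  = -_
  ; 0#  = fromPoly P.0#
  ; 1#  = fromPoly P.1#
  }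

open SemiringDefs (RawRing.rawSemiring ℚ⟨q⟩-rawRing) public using (_^_; sum)

-- Inclusive upper bound: the sum runs over 0 ≤ k ≤ m.
sum≤ : ℕ → (ℕ → ℚ⟨q⟩) → ℚ⟨q⟩
sum≤ m t = sum {suc m} λ k → t (toℕ k)

infix 5 sum≤
syntax sum≤ m (λ k → t) = ∑[ k ≤ m ] t

infixr 8 _^ℤ_[_]

_^ℤ_[_] : (A : ℚ⟨q⟩) → ℤ → num A P.≉ P.0# → ℚ⟨q⟩
A ^ℤ + m      [ _   ] = A ^ m
A ^ℤ -[1+ m ] [ A≉0 ] = (den A / num A [ A≉0 ]) ^ suc m

-q≉0 : num (- q) P.≉ P.0#
-q≉0 -q≈0 with () ← -q≈0 .P.coeff≡ 1

-- A fraction in lowest terms is unique up to a nonzero constant, so it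
-- does not matter which one is exhibited.

infix 4 _≡_[mod_]

record _≡_[mod_] (A B : ℚ⟨q⟩) (M : ℚ[q]) : Set where
  field
    lowest-terms : ℚ⟨q⟩
    represents   : A - B ≃ lowest-terms
    coprime      : P.Coprime (num lowest-terms) (den lowest-terms)
    divides      : M P.∣ num lowest-terms

{-# OPTIONS --safe #-}

-- Put z = qⁿ.  Modulo Φₙ(q)² we have (1 - z)² = 0, hence z + 1/z = 2 and
--   (q;q²)ₖ² = fₖ(z),  where  fₖ(z) = ∏_{j<k} (1 - q^{2j+1} z) (1 - q^{2j+1} / z),
-- so the sum in question is S(qⁿ) for
--   S(z) = ∑_{k ≤ N} tₖ(z),  tₖ(z) = q^{k²} fₖ(z) / ((q;q²)ₖ (q⁴;q⁴)ₖ),  n = 2N+1.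
-- The summands telescope in the combination
--   ∑_{k ≤ N} (tₖ(q² z) + z⁻¹ tₖ(z / q²)) = (1 + z⁻¹) q^{2N} t_N(z),
-- whose right-hand side vanishes at z = q^{2i+1} for i < N, so that
-- S(q^{2i+3}) = - q^{-(2i+1)} S(q^{2i-1}).  As S(q) = S(q⁻¹) = 1, this gives
-- S(q^{2i+1}) = (-q)^{-i(i+1)/2}.  The denominators are invertible modulo Φₙ(q)²
-- because Φₙ(q) and q^m - 1 generate the unit ideal when n ∤ m.

module Submission where

open import Algebra.Bundles using (CommutativeMonoid; CommutativeRing; Monoid)
open import Algebra.Definitions.RawMagma using (_,_; module _∣ʳ_)
import Algebra.Properties.CommutativeSemigroup as CommutativeSemigroupProperties
import Algebra.Properties.Monoid.Sum as MonoidSum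
import Algebra.Properties.Semiring.Exp as SemiringExp
import Algebra.Properties.Semiring.Mult as SemiringMult
open import Algebra.Solver.Ring.AlmostCommutativeRing
  using (fromCommutativeRing; _-Raw-AlmostCommutative⟶_)
open import Data.Bool.Base using (if_then_else_)
open import Data.Fin.Base using (Fin; zero; suc; toℕ)
open import Data.Fin.Properties using (toℕ<n; toℕ-fromℕ; toℕ-inject₁)
open import Data.Integer.Base as ℤ using (ℤ; +_; -[1+_]; 1ℤ)
import Data.Integer.Properties as ℤ
open import Data.List.Base using ([]; _∷_)
open import Data.List.Relation.Unary.All using (All; all?; []; _∷_)
open import Data.Maybe.Base using (Maybe; just; nothing)
open import Data.Nat.Base as ℕ using (ℕ; zero; suc)
import Data.Nat.Divisibility as ℕ
import Data.Nat.DivMod as ℕ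
import Data.Nat.GCD as ℕ
open import Data.Nat.Induction using (Acc; acc; <-rec; <-wellFounded)
import Data.Nat.Properties as ℕ
open import Data.Nat.Tactic.RingSolver using (solve-∀)
open import Data.Product.Base using (∃; ∃₂; _×_; _,_; proj₁; proj₂)
open import Data.Rational.Base as ℚ using (ℚ; 0ℚ; 1ℚ)
import Data.Rational.Properties as ℚ
open import Data.Sum.Base as Sum using (_⊎_; inj₁; inj₂)
open import Defs using (ℚ[q]; coeff; module P; Φ)
open import Induction.WellFounded using (module FixPoint)
open import Level using (Level; _⊔_; 0ℓ)
open import Relation.Binary.Definitions using (tri<; tri≈; tri>)
open import Relation.Binary.PropositionalEquality as ≡ using (_≡_; _≢_)
open import Relation.Nullary using (¬_; contradiction; does; no; yes)

open P using (coeffwise; coeff≡)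

-- The variable z is never an indeterminate: the whole computation takes place in ℚ[q] modulo
-- Φₙ(q)², where q is a unit, and z runs through odd powers of q, so z and its inverse are passed as
-- two elements `z` and `u` with product 1. The target z = qⁿ is the point i = N of the family
-- q^{2i+1}. The obstacle is that 1 - qⁿ is nilpotent there, so reciprocals of 1 - q^{2j+1} exist
-- only for j < N; this is just enough for partial sums with k ≤ N. A second obstacle is that `Φ` is
-- defined by long division, so even its dividing qⁿ - 1 has to be proved. Exactness of the division
-- at n requires the earlier Φ_d to be pairwise comaximal, which in turn rests on exactness at
-- smaller indices; a strong induction carries both. Comaximality is used instead of coprimality
-- because it yields inverses in the quotient ring and passes from Φₙ to its square. Lowest terms
-- matter only when a congruence in the quotient ring is turned back into one between rational
-- functions, and Euclid's algorithm provides them.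

-- A solver with integer coefficients for an arbitrary commutative ring.

module RingSolver {c ℓ : Level} (R : CommutativeRing c ℓ) where
  open CommutativeRing R
  open import Algebra.Properties.Ring ring
  open import Algebra.Properties.Semiring.Mult.TCOptimised semiring
    using (1+×; ×-homo-+; ×1-homo-*) renaming (_×_ to _×′_)
  open import Relation.Binary.Reasoning.Setoid setoid

  -- Equality in a quotient ring is not decided, so the solver computes with integers as
  -- coefficients. The optimised multiple makes `⟦ + 1 ⟧` the element `1#` itself, so that `:1`
  -- stands for `1#` definitionally.
  ⟦_⟧ : ℤ → Carrier
  ⟦ + n ⟧      = n ×′ 1#
  ⟦ -[1+ n ] ⟧ = - (suc n ×′ 1#)

  ⟦-⟧ : ∀ i → ⟦ ℤ.- i ⟧ ≈ - ⟦ i ⟧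
  ⟦-⟧ (+ zero)  = sym -0#≈0#
  ⟦-⟧ (+ suc n) = refl
  ⟦-⟧ -[1+ n ]  = sym (-‿involutive _)

  1+x-[1+y] : ∀ x y → (1# + x) - (1# + y) ≈ x - y
  1+x-[1+y] x y = begin
    (1# + x) - (1# + y)     ≈⟨ +-congˡ (-‿+-comm 1# y) ⟨
    (1# + x) + (- 1# - y)   ≈⟨ +-assoc _ _ _ ⟨
    ((1# + x) - 1#) - y     ≈⟨ +-congʳ (xyx⁻¹≈y 1# x) ⟩
    x - y                   ∎

  ⟦⊖⟧ : ∀ m n → ⟦ m ℤ.⊖ n ⟧ ≈ m ×′ 1# - n ×′ 1#
  ⟦⊖⟧ m       zero    = sym (trans (+-congˡ -0#≈0#) (+-identityʳ _))
  ⟦⊖⟧ zero    (suc n) = sym (+-identityˡ _)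
  ⟦⊖⟧ (suc m) (suc n) = begin
    ⟦ suc m ℤ.⊖ suc n ⟧                 ≡⟨ ≡.cong ⟦_⟧ (ℤ.[1+m]⊖[1+n]≡m⊖n m n) ⟩
    ⟦ m ℤ.⊖ n ⟧                         ≈⟨ ⟦⊖⟧ m n ⟩
    m ×′ 1# - n ×′ 1#                   ≈⟨ 1+x-[1+y] _ _ ⟨
    (1# + m ×′ 1#) - (1# + n ×′ 1#)     ≈⟨ +-cong (1+× m 1#) (-‿cong (1+× n 1#)) ⟨
    suc m ×′ 1# - suc n ×′ 1#           ∎

  ⟦+⟧ : ∀ i j → ⟦ i ℤ.+ j ⟧ ≈ ⟦ i ⟧ + ⟦ j ⟧
  ⟦+⟧ (+ m)    (+ n)    = ×-homo-+ 1# m n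
  ⟦+⟧ (+ m)    -[1+ n ] = ⟦⊖⟧ m (suc n)
  ⟦+⟧ -[1+ m ] (+ n)    = trans (⟦⊖⟧ n (suc m)) (+-comm _ _)
  ⟦+⟧ -[1+ m ] -[1+ n ] = begin
    - (suc (suc (m ℕ.+ n)) ×′ 1#)         ≡⟨ ≡.cong (λ k → - (k ×′ 1#)) (ℕ.+-suc (suc m) n) ⟨
    - ((suc m ℕ.+ suc n) ×′ 1#)           ≈⟨ -‿cong (×-homo-+ 1# (suc m) (suc n)) ⟩
    - (suc m ×′ 1# + suc n ×′ 1#)         ≈⟨ -‿+-comm _ _ ⟨
    - (suc m ×′ 1#) - (suc n ×′ 1#)       ∎

  ⟦*+⟧ : ∀ i n → ⟦ i ℤ.* + n ⟧ ≈ ⟦ i ⟧ * ⟦ + n ⟧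
  ⟦*+⟧ (+ m)    n = trans (reflexive (≡.cong ⟦_⟧ (≡.sym (ℤ.pos-* m n)))) (×1-homo-* m n)
  ⟦*+⟧ -[1+ m ] n = begin
    ⟦ -[1+ m ] ℤ.* + n ⟧        ≡⟨ ≡.cong ⟦_⟧ (ℤ.neg-distribˡ-* (+ suc m) (+ n)) ⟨
    ⟦ ℤ.- (+ suc m ℤ.* + n) ⟧   ≈⟨ ⟦-⟧ (+ suc m ℤ.* + n) ⟩
    - ⟦ + suc m ℤ.* + n ⟧       ≈⟨ -‿cong (⟦*+⟧ (+ suc m) n) ⟩
    - (⟦ + suc m ⟧ * ⟦ + n ⟧)   ≈⟨ -‿distribˡ-* _ _ ⟩
    ⟦ -[1+ m ] ⟧ * ⟦ + n ⟧      ∎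

  ⟦*⟧ : ∀ i j → ⟦ i ℤ.* j ⟧ ≈ ⟦ i ⟧ * ⟦ j ⟧
  ⟦*⟧ i (+ n)    = ⟦*+⟧ i n
  ⟦*⟧ i -[1+ n ] = begin
    ⟦ i ℤ.* -[1+ n ] ⟧          ≡⟨ ≡.cong ⟦_⟧ (ℤ.neg-distribʳ-* i (+ suc n)) ⟨
    ⟦ ℤ.- (i ℤ.* + suc n) ⟧     ≈⟨ ⟦-⟧ (i ℤ.* + suc n) ⟩
    - ⟦ i ℤ.* + suc n ⟧         ≈⟨ -‿cong (⟦*+⟧ i (suc n)) ⟩
    - (⟦ i ⟧ * ⟦ + suc n ⟧)     ≈⟨ -‿distribʳ-* _ _ ⟩
    ⟦ i ⟧ * ⟦ -[1+ n ] ⟧        ∎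

  ℤ⟶R : ℤ.+-*-rawRing -Raw-AlmostCommutative⟶ fromCommutativeRing R
  ℤ⟶R = record
    { ⟦_⟧    = ⟦_⟧
    ; +-homo = ⟦+⟧
    ; *-homo = ⟦*⟧
    ; -‿homo = ⟦-⟧
    ; 0-homo = refl
    ; 1-homo = refl
    }

  ⟦≟⟧ : ∀ i j → Maybe (⟦ i ⟧ ≈ ⟦ j ⟧)
  ⟦≟⟧ i j with i ℤ.≟ j
  ... | yes ≡.refl = just refl
  ... | no  _      = nothing

  open import Algebra.Solver.Ring _ _ ℤ⟶R ⟦≟⟧ public
    using (Polynomial; con; _:+_; _:*_; _:-_; :-_; _:^_; _:=_; solve)

  :1 : ∀ {n} → Polynomial n
  :1 = con (+ 1)

-- Comaximality, quotient rings and the elements x^m - 1.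

module RingTheory {c ℓ : Level} (R : CommutativeRing c ℓ) where
  open CommutativeRing R
  open import Algebra.Properties.Ring ring
  open import Algebra.Properties.Semiring.Divisibility semiring public
    using (_∣_; ∣ʳ-trans; ∣ʳ-refl; ∣ʳ-respʳ-≈; ∣ʳ-respˡ-≈)
  open import Algebra.Properties.CommutativeSemigroup.Divisibility *-commutativeSemigroup public
    using (x∣xy; ∙-cong-∣)
  open import Algebra.Properties.Semiring.Mult semiring using () renaming (_×_ to _×′_)
  open import Algebra.Properties.Semiring.Exp semiring using (_^_; ^-congˡ; ^-homo-*; ^-assocʳ)
  open import Relation.Binary.Reasoning.Setoid setoid
  open RingSolver R

  -- A Bézout identity makes `y` a unit modulo `x`; the mere absence of common factors would not, in
  -- a general ring.
  Comaximal : Carrier → Carrier → Set (c ⊔ ℓ)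
  Comaximal x y = ∃₂ λ a b → a * x + b * y ≈ 1#

  Comaximal-sym : ∀ {x y} → Comaximal x y → Comaximal y x
  Comaximal-sym (a , b , e) = b , a , trans (+-comm _ _) e

  Comaximal-* : ∀ {x y z} → Comaximal x y → Comaximal x z → Comaximal x (y * z)
  Comaximal-* {x} {y} {z} (a , b , e) (a′ , b′ , e′) =
    a * a′ * x + a * b′ * z + b * y * a′ , b * b′ , (begin
    (a * a′ * x + a * b′ * z + b * y * a′) * x + b * b′ * (y * z)
      ≈⟨ solve 7 (λ a b a′ b′ x y z →
           (a :* a′ :* x :+ a :* b′ :* z :+ b :* y :* a′) :* x :+ b :* b′ :* (y :* z)
           := (a :* x :+ b :* y) :* (a′ :* x :+ b′ :* z)) refl a b a′ b′ x y z ⟩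
    (a * x + b * y) * (a′ * x + b′ * z)
      ≈⟨ *-cong e e′ ⟩
    1# * 1#
      ≈⟨ *-identityˡ 1# ⟩
    1# ∎)

  Comaximal-1 : ∀ x → Comaximal x 1#
  Comaximal-1 x = 0# , 1# , trans (+-cong (zeroˡ x) (*-identityˡ 1#)) (+-identityˡ 1#)

  Comaximal-∣ : ∀ {x y z} → Comaximal x y → z ∣ y → Comaximal x z
  Comaximal-∣ {x} (a , b , e) (k , kz≈y) =
    a , b * k , trans (+-congˡ (trans (*-assoc b k _) (*-congˡ kz≈y))) e

  Comaximal-resp : ∀ {x y z} → y ≈ z → Comaximal x y → Comaximal x z
  Comaximal-resp y≈z (a , b , e) = a , b , trans (+-congˡ (*-congˡ (sym y≈z))) e

  -- Modulo `x` the element `y` is the unit `c`, with inverse `u`.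
  unit+multiple-comaximal : ∀ {x h y c u} → c * u ≈ 1# → y ≈ c + h * x → Comaximal x y
  unit+multiple-comaximal {x} {h} {y} {c} {u} cu≈1 y≈ = - h * u , u , (begin
    - h * u * x + u * y
      ≈⟨ +-congˡ (*-congˡ y≈) ⟩
    - h * u * x + u * (c + h * x)
      ≈⟨ solve 4 (λ h u x c → :- h :* u :* x :+ u :* (c :+ h :* x) := c :* u) refl h u x c ⟩
    c * u
      ≈⟨ cu≈1 ⟩
    1# ∎)

  Comaximal⇒*∣ : ∀ {x y z} → Comaximal x y → x ∣ z → y ∣ z → x * y ∣ z
  Comaximal⇒*∣ {x} {y} {z} (a , b , e) (k , kx≈z) (l , ly≈z) = a * l + b * k , (begin
    (a * l + b * k) * (x * y)
      ≈⟨ solve 6 (λ a b k l x y → (a :* l :+ b :* k) :* (x :* y)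
           := a :* x :* (l :* y) :+ b :* y :* (k :* x)) refl a b k l x y ⟩
    a * x * (l * y) + b * y * (k * x)
      ≈⟨ +-cong (*-congˡ ly≈z) (*-congˡ kx≈z) ⟩
    a * x * z + b * y * z
      ≈⟨ distribʳ z _ _ ⟨
    (a * x + b * y) * z
      ≈⟨ *-congʳ e ⟩
    1# * z
      ≈⟨ *-identityˡ z ⟩
    z ∎)

  Comaximal⇒Coprime : ∀ {x y} → Comaximal x y → ∀ {z} → z ∣ x → z ∣ y → z ∣ 1#
  Comaximal⇒Coprime {x} {y} (a , b , e) {z} (k , kz≈x) (l , lz≈y) = a * k + b * l , (begin
    (a * k + b * l) * z
      ≈⟨ solve 5 (λ a b k l z → (a :* k :+ b :* l) :* z
           := a :* (k :* z) :+ b :* (l :* z)) refl a b k l z ⟩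
    a * (k * z) + b * (l * z)
      ≈⟨ +-cong (*-congˡ kz≈x) (*-congˡ lz≈y) ⟩
    a * x + b * y
      ≈⟨ e ⟩
    1# ∎)

  -- Working modulo M keeps the carrier and coarsens the equality.
  module _ (M : Carrier) where

    infix 4 _≋_
    record _≋_ (x y : Carrier) : Set (c ⊔ ℓ) where
      constructor congruent
      field
        M∣x-y : M ∣ x - y

    open _≋_ public

    ≈⇒≋ : ∀ {x y} → x ≈ y → x ≋ y
    ≈⇒≋ {x} {y} x≈y = congruent (0# , (begin
      0# * M ≈⟨ zeroˡ M ⟩
      0#     ≈⟨ -‿inverseʳ y ⟨
      y - y  ≈⟨ +-congʳ x≈y ⟨
      x - y  ∎))

    ≋-sym : ∀ {x y} → x ≋ y → y ≋ x
    ≋-sym {x} {y} (congruent (k , e)) = congruent (- k , (begin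
      - k * M    ≈⟨ -‿distribˡ-* k M ⟨
      - (k * M)  ≈⟨ -‿cong e ⟩
      - (x - y)  ≈⟨ solve 2 (λ x y → :- (x :- y) := y :- x) refl x y ⟩
      y - x      ∎))

    ≋-trans : ∀ {x y z} → x ≋ y → y ≋ z → x ≋ z
    ≋-trans {x} {y} {z} (congruent (k , e)) (congruent (l , e′)) = congruent (k + l , (begin
      (k + l) * M        ≈⟨ distribʳ M k l ⟩
      k * M + l * M      ≈⟨ +-cong e e′ ⟩
      (x - y) + (y - z)  ≈⟨ solve 3 (λ x y z → (x :- y) :+ (y :- z) := x :- z) refl x y z ⟩
      x - z              ∎))

    ≋-+-cong : ∀ {x y u v} → x ≋ y → u ≋ v → x + u ≋ y + v
    ≋-+-cong {x} {y} {u} {v} (congruent (k , e)) (congruent (l , e′)) = congruent (k + l , (begin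
      (k + l) * M        ≈⟨ distribʳ M k l ⟩
      k * M + l * M      ≈⟨ +-cong e e′ ⟩
      (x - y) + (u - v)
        ≈⟨ solve 4 (λ x y u v → (x :- y) :+ (u :- v) := (x :+ u) :- (y :+ v)) refl x y u v ⟩
      (x + u) - (y + v)  ∎))

    ≋-*-cong : ∀ {x y u v} → x ≋ y → u ≋ v → x * u ≋ y * v
    ≋-*-cong {x} {y} {u} {v} (congruent (k , e)) (congruent (l , e′)) =
      congruent (k * u + y * l , (begin
      (k * u + y * l) * M
        ≈⟨ solve 5 (λ k l u y M → (k :* u :+ y :* l) :* M
             := (k :* M) :* u :+ y :* (l :* M)) refl k l u y M ⟩
      (k * M) * u + y * (l * M)
        ≈⟨ +-cong (*-congʳ e) (*-congˡ e′) ⟩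
      (x - y) * u + y * (u - v)
        ≈⟨ solve 4 (λ x y u v → (x :- y) :* u :+ y :* (u :- v) := x :* u :- y :* v) refl x y u v ⟩
      x * u - y * v  ∎))

    ≋-‿cong : ∀ {x y} → x ≋ y → - x ≋ - y
    ≋-‿cong {x} {y} (congruent (k , e)) = congruent (- k , (begin
      - k * M    ≈⟨ -‿distribˡ-* k M ⟨
      - (k * M)  ≈⟨ -‿cong e ⟩
      - (x - y)  ≈⟨ solve 2 (λ x y → :- (x :- y) := :- x :- :- y) refl x y ⟩
      - x - - y  ∎))

    R/M : CommutativeRing c (c ⊔ ℓ)
    R/M = record
      { Carrier = Carrier
      ; _≈_ = _≋_
      ; _+_ = _+_
      ; _*_ = _*_
      ; -_  = -_
      ; 0#  = 0#
      ; 1#  = 1#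
      ; isCommutativeRing = record
        { isRing = record
          { +-isAbelianGroup = record
            { isGroup = record
              { isMonoid = record
                { isSemigroup = record
                  { isMagma = record
                    { isEquivalence = record
                      { refl = ≈⇒≋ refl ; sym = ≋-sym ; trans = ≋-trans }
                    ; ∙-cong = ≋-+-cong
                    }
                  ; assoc = λ x y z → ≈⇒≋ (+-assoc x y z)
                  }
                ; identity = (λ x → ≈⇒≋ (+-identityˡ x)) , λ x → ≈⇒≋ (+-identityʳ x)
                }
              ; inverse = (λ x → ≈⇒≋ (-‿inverseˡ x)) , λ x → ≈⇒≋ (-‿inverseʳ x)
              ; ⁻¹-cong = ≋-‿cong
              }
            ; comm = λ x y → ≈⇒≋ (+-comm x y)
            }
          ; *-cong = ≋-*-cong
          ; *-assoc = λ x y z → ≈⇒≋ (*-assoc x y z)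
          ; *-identity = (λ x → ≈⇒≋ (*-identityˡ x)) , λ x → ≈⇒≋ (*-identityʳ x)
          ; distrib = (λ x y z → ≈⇒≋ (distribˡ x y z)) , λ x y z → ≈⇒≋ (distribʳ x y z)
          }
        ; *-comm = λ x y → ≈⇒≋ (*-comm x y)
        }
      }

    ∣⇒≋0 : ∀ {x} → M ∣ x → x ≋ 0#
    ∣⇒≋0 {x} (k , e) =
      congruent (k , trans e (solve 1 (λ x → x := x :- con (+ 0)) refl x))

    ≋0⇒∣ : ∀ {x} → x ≋ 0# → M ∣ x
    ≋0⇒∣ {x} (congruent (k , e)) = k , trans e (solve 1 (λ x → x :- con (+ 0) := x) refl x)

    Comaximal⇒inverse : ∀ {x} → Comaximal M x → ∃ λ y → x * y ≋ 1#
    Comaximal⇒inverse {x} (a , b , e) = b , ≋-sym (congruent (a , (begin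
      a * M
        ≈⟨ solve 4 (λ a b x M → a :* M := (a :* M :+ b :* x) :- x :* b) refl a b x M ⟩
      (a * M + b * x) - x * b
        ≈⟨ +-congʳ e ⟩
      1# - x * b ∎)))

    inverse⇒Comaximal : ∀ {x} → (∃ λ y → x * y ≋ 1#) → Comaximal M x
    inverse⇒Comaximal {x} (y , congruent (k , e)) = - k , y , (begin
      - k * M + y * x          ≈⟨ +-congʳ (-‿distribˡ-* k M) ⟨
      - (k * M) + y * x        ≈⟨ +-congʳ (-‿cong e) ⟩
      - (x * y - 1#) + y * x   ≈⟨ solve 2 (λ x y → :- (x :* y :- :1) :+ y :* x := :1) refl x y ⟩
      1#                       ∎)

  x-1∣x^m-1 : ∀ x m → x - 1# ∣ x ^ m - 1#
  x-1∣x^m-1 x zero    = 0# , trans (zeroˡ _) (sym (-‿inverseʳ 1#))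
  x-1∣x^m-1 x (suc m) with (k , e) ← x-1∣x^m-1 x m = 1# + x * k , (begin
    (1# + x * k) * (x - 1#)
      ≈⟨ solve 2 (λ x k → (:1 :+ x :* k) :* (x :- :1)
           := (x :- :1) :+ x :* (k :* (x :- :1))) refl x k ⟩
    (x - 1#) + x * (k * (x - 1#))
      ≈⟨ +-congˡ (*-congˡ e) ⟩
    (x - 1#) + x * (x ^ m - 1#)
      ≈⟨ solve 2 (λ x y → (x :- :1) :+ x :* (y :- :1) := x :* y :- :1) refl x (x ^ m) ⟩
    x * x ^ m - 1# ∎)

  x^d-1∣x^n-1 : ∀ x {d n} → d ℕ.∣ n → x ^ d - 1# ∣ x ^ n - 1#
  x^d-1∣x^n-1 x {d} (ℕ.divides-refl e) = ∣ʳ-respʳ-≈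
    (+-congʳ (trans (^-assocʳ x d e) (reflexive (≡.cong (x ^_) (ℕ.*-comm d e)))))
    (x-1∣x^m-1 (x ^ d) e)

  x^[d+i]-1 : ∀ x d i {j} → d ℕ.+ i ≡ j →
    x ^ d - 1# ≈ (x ^ j - 1#) - x ^ d * (x ^ i - 1#)
  x^[d+i]-1 x d i ≡.refl = begin
    x ^ d - 1#
      ≈⟨ solve 2 (λ a b → a :- :1 := (a :* b :- :1) :- a :* (b :- :1)) refl (x ^ d) (x ^ i) ⟩
    (x ^ d * x ^ i - 1#) - x ^ d * (x ^ i - 1#)
      ≈⟨ +-congʳ (+-congʳ (^-homo-* x d i)) ⟨
    (x ^ (d ℕ.+ i) - 1#) - x ^ d * (x ^ i - 1#) ∎

  -- Bézout's identity in ℕ reads g + n b = m a, or the same with a and b exchanged. Taken in the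
  -- exponents it gives x^g - 1 = (x^{ma} - 1) - x^g (x^{nb} - 1), without negative powers of x.
  x^gcd-1 : ∀ x {a b g} → ℕ.GCD a b g → ∃₂ λ s t →
    x ^ g - 1# ≈ s * (x ^ a - 1#) + t * (x ^ b - 1#)
  x^gcd-1 x {a} {b} {g} isGCD with ℕ.Bézout.identity isGCD
  ... | ℕ.Bézout.+- m n eq
      with (k , e) ← x^d-1∣x^n-1 x (ℕ.n∣m*n m {a}) | (l , e′) ← x^d-1∣x^n-1 x (ℕ.n∣m*n n {b}) =
    k , - x ^ g * l , (begin
      x ^ g - 1#
        ≈⟨ x^[d+i]-1 x g (n ℕ.* b) eq ⟩
      (x ^ (m ℕ.* a) - 1#) - x ^ g * (x ^ (n ℕ.* b) - 1#)
        ≈⟨ +-cong e (-‿cong (*-congˡ e′)) ⟨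
      k * (x ^ a - 1#) - x ^ g * (l * (x ^ b - 1#))
        ≈⟨ solve 4 (λ y g l z → y :- g :* (l :* z) := y :+ :- g :* l :* z) refl _ _ _ _ ⟩
      k * (x ^ a - 1#) + - x ^ g * l * (x ^ b - 1#) ∎)
  ... | ℕ.Bézout.-+ m n eq
      with (k , e) ← x^d-1∣x^n-1 x (ℕ.n∣m*n m {a}) | (l , e′) ← x^d-1∣x^n-1 x (ℕ.n∣m*n n {b}) =
    - x ^ g * k , l , (begin
      x ^ g - 1#
        ≈⟨ x^[d+i]-1 x g (m ℕ.* a) eq ⟩
      (x ^ (n ℕ.* b) - 1#) - x ^ g * (x ^ (m ℕ.* a) - 1#)
        ≈⟨ +-cong e′ (-‿cong (*-congˡ e)) ⟨
      l * (x ^ b - 1#) - x ^ g * (k * (x ^ a - 1#))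
        ≈⟨ solve 4 (λ y g k z → y :- g :* (k :* z) := :- g :* k :* z :+ y) refl _ _ _ _ ⟩
      - x ^ g * k * (x ^ a - 1#) + l * (x ^ b - 1#) ∎)

  -- Modulo `w` the term with `x ^ a - 1` drops out of the combination in `x^gcd-1`, so that the
  -- unit `x ^ ℕ.gcd a b - 1#` becomes a multiple of `x ^ b - 1#`.
  Comaximal-x^gcd-1 : ∀ {w} x a b → w ∣ x ^ a - 1# →
    Comaximal w (x ^ ℕ.gcd a b - 1#) → Comaximal w (x ^ b - 1#)
  Comaximal-x^gcd-1 {w} x a b (k , kw≈) (α , β , e)
    with s , t , e′ ← x^gcd-1 x (ℕ.gcd-GCD a b) = α + β * s * k , β * t , (begin
    (α + β * s * k) * w + β * t * (x ^ b - 1#)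
      ≈⟨ solve 7 (λ α β s k w t z → (α :+ β :* s :* k) :* w :+ β :* t :* z
           := α :* w :+ β :* (s :* (k :* w) :+ t :* z)) refl α β s k w t (x ^ b - 1#) ⟩
    α * w + β * (s * (k * w) + t * (x ^ b - 1#))
      ≈⟨ +-congˡ (*-congˡ (trans (+-congʳ (*-congˡ kw≈)) (sym e′))) ⟩
    α * w + β * (x ^ ℕ.gcd a b - 1#)
      ≈⟨ e ⟩
    1# ∎)

  -- The quotient is 1 + y + … + y^(e-1), and each of its terms is 1 modulo y - 1.
  geometric : ∀ y e → ∃₂ λ m h →
    m * (y - 1#) ≈ y ^ e - 1# × m ≈ e ×′ 1# + h * (y - 1#)
  geometric y zero = 0# , 0# ,
    trans (zeroˡ _) (sym (-‿inverseʳ 1#)) , sym (trans (+-identityˡ _) (zeroˡ _))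
  geometric y (suc e) with m , h , m[y-1]≈ , m≈ ← geometric y e =
    1# + y * m , e ×′ 1# + y * h , (begin
      (1# + y * m) * (y - 1#)
        ≈⟨ solve 2 (λ y m → (:1 :+ y :* m) :* (y :- :1)
             := (y :- :1) :+ y :* (m :* (y :- :1))) refl y m ⟩
      (y - 1#) + y * (m * (y - 1#))
        ≈⟨ +-congˡ (*-congˡ m[y-1]≈) ⟩
      (y - 1#) + y * (y ^ e - 1#)
        ≈⟨ solve 2 (λ y z → (y :- :1) :+ y :* (z :- :1) := y :* z :- :1) refl y (y ^ e) ⟩
      y * y ^ e - 1# ∎) , (begin
      1# + y * m
        ≈⟨ +-congˡ (*-congˡ m≈) ⟩
      1# + y * (e ×′ 1# + h * (y - 1#))
        ≈⟨ solve 3 (λ y c h → :1 :+ y :* (c :+ h :* (y :- :1))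
             := (:1 :+ c) :+ (c :+ y :* h) :* (y :- :1)) refl y (e ×′ 1#) h ⟩
      (1# + e ×′ 1#) + (e ×′ 1# + y * h) * (y - 1#) ∎)

  Comaximal-1-x : ∀ {w x} → Comaximal w (x - 1#) → Comaximal w (1# - x)
  Comaximal-1-x {w} {x} coprime = Comaximal-∣ coprime
    (- 1# , solve 1 (λ x → :- :1 :* (:1 :- x) := x :- :1) refl x)

  Comaximal-^2ˡ : ∀ {x y} → Comaximal x y → Comaximal (x ^ 2) y
  Comaximal-^2ˡ coprime = Comaximal-sym
    (Comaximal-* (Comaximal-sym coprime) (Comaximal-* (Comaximal-sym coprime) (Comaximal-1 _)))

  ∣x-1⇒^2∣[1-x]^2 : ∀ {w x} → w ∣ x - 1# → w ^ 2 ∣ (1# - x) ^ 2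
  ∣x-1⇒^2∣[1-x]^2 {w} {x} (k , kw≈x-1) = k ^ 2 , (begin
    k ^ 2 * w ^ 2   ≈⟨ solve 2 (λ k w → k :^ 2 :* w :^ 2 := (k :* w) :^ 2) refl k w ⟩
    (k * w) ^ 2     ≈⟨ ^-congˡ 2 kw≈x-1 ⟩
    (x - 1#) ^ 2    ≈⟨ solve 1 (λ x → (x :- :1) :^ 2 := (:1 :- x) :^ 2) refl x ⟩
    (1# - x) ^ 2    ∎)

  -- Modulo `w` the power `x ^ n` is inverse to `x`.
  ∣x^[1+n]-1⇒Comaximal : ∀ {w x} n → w ∣ x ^ suc n - 1# → Comaximal w x
  ∣x^[1+n]-1⇒Comaximal {w} {x} n (k , kw≈) = - k , x ^ n , (begin
    - k * w + x ^ n * x               ≈⟨ +-congʳ (-‿distribˡ-* k w) ⟨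
    - (k * w) + x ^ n * x             ≈⟨ +-congʳ (-‿cong kw≈) ⟩
    - (x * x ^ n - 1#) + x ^ n * x
      ≈⟨ solve 2 (λ x y → :- (x :* y :- :1) :+ y :* x := :1) refl x (x ^ n) ⟩
    1#                                ∎)

  -- Comaximal cofactors replace the universal property: they are what a fraction in lowest terms
  -- needs.
  record Gcd (x y : Carrier) : Set (c ⊔ ℓ) where
    field
      divisor x′ y′ : Carrier
      x≈ : x ≈ divisor * x′
      y≈ : y ≈ divisor * y′
      comaximal : Comaximal x′ y′

  gcd-0ʳ : ∀ {x y} → y ≈ 0# → Gcd x y
  gcd-0ʳ {x} y≈0 = record
    { divisor = x ; x′ = 1# ; y′ = 0#
    ; x≈ = sym (*-identityʳ x) ; y≈ = trans y≈0 (sym (zeroʳ x))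
    ; comaximal = Comaximal-sym (Comaximal-1 0#)
    }

  gcd-step : ∀ {x y z} u → x ≈ u * y + z → Gcd y z → Gcd x y
  gcd-step {x} {y} {z} u x≈uy+z g = record
    { divisor = divisor ; x′ = u * x′ + y′ ; y′ = x′
    ; x≈ = begin
        x                                       ≈⟨ x≈uy+z ⟩
        u * y + z                               ≈⟨ +-cong (*-congˡ x≈) y≈ ⟩
        u * (divisor * x′) + divisor * y′
          ≈⟨ solve 4 (λ u d x′ y′ → u :* (d :* x′) :+ d :* y′ := d :* (u :* x′ :+ y′))
               refl u divisor x′ y′ ⟩
        divisor * (u * x′ + y′)                 ∎
    ; y≈ = x≈
    -- Obtained from a x′ + b y′ = 1 by writing y′ as (u x′ + y′) - u x′.
    ; comaximal = b , a - b * u , (begin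
        b * (u * x′ + y′) + (a - b * u) * x′
          ≈⟨ solve 5 (λ a b u x′ y′ → b :* (u :* x′ :+ y′) :+ (a :- b :* u) :* x′
               := a :* x′ :+ b :* y′) refl a b u x′ y′ ⟩
        a * x′ + b * y′                         ≈⟨ e ⟩
        1#                                      ∎)
    }
    where
    open Gcd g
    a = proj₁ comaximal
    b = proj₁ (proj₂ comaximal)
    e = proj₂ (proj₂ comaximal)

  -- Allows Euclid's algorithm to rescale a divisor to a monic polynomial.
  gcd-unit : ∀ {x y} a b → a * b ≈ 1# → Gcd x (b * y) → Gcd x y
  gcd-unit {x} {y} a b ab≈1 g = record
    { divisor = divisor ; x′ = x′ ; y′ = a * y′
    ; x≈ = x≈
    ; y≈ = begin
        y                     ≈⟨ *-identityˡ y ⟨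
        1# * y                ≈⟨ *-congʳ ab≈1 ⟨
        a * b * y             ≈⟨ *-assoc a b y ⟩
        a * (b * y)           ≈⟨ *-congˡ y≈ ⟩
        a * (divisor * y′)    ≈⟨ solve 3 (λ a d y → a :* (d :* y) := d :* (a :* y)) refl a divisor y′ ⟩
        divisor * (a * y′)    ∎
    ; comaximal = Comaximal-∣ comaximal (b , (begin
        b * (a * y′)  ≈⟨ solve 3 (λ a b y → b :* (a :* y) := a :* b :* y) refl a b y′ ⟩
        a * b * y′    ≈⟨ *-congʳ ab≈1 ⟩
        1# * y′       ≈⟨ *-identityˡ y′ ⟩
        y′            ∎))
    }
    where open Gcd g

-- Values of fractions whose denominator is a unit.

module Quotients {c ℓ : Level} (R : CommutativeRing c ℓ) where
  open CommutativeRing R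
  open import Algebra.Properties.Ring ring
  open import Algebra.Properties.Monoid.Sum *-monoid using () renaming (sum to product)
  open import Relation.Binary.Reasoning.Setoid setoid
  open RingSolver R

  -- A relation and not a function of the fraction x/y, since only some denominators are invertible.
  -- The value `a` is determined up to equality because `y` is a unit.
  record IsQuotient (x y a : Carrier) : Set (c ⊔ ℓ) where
    constructor isQuotient
    field
      y⁻¹   : Carrier
      yy⁻¹≈1 : y * y⁻¹ ≈ 1#
      x≈ay  : x ≈ a * y

  IsQuotient-resp : ∀ {x y a b} → a ≈ b → IsQuotient x y a → IsQuotient x y b
  IsQuotient-resp a≈b (isQuotient v yv≈1 x≈ay) =
    isQuotient v yv≈1 (trans x≈ay (*-congʳ a≈b))

  IsQuotient-/1 : ∀ x → IsQuotient x 1# x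
  IsQuotient-/1 x = isQuotient 1# (*-identityˡ 1#) (sym (*-identityʳ x))

  IsQuotient-/ : ∀ x {y v} → y * v ≈ 1# → IsQuotient x y (x * v)
  IsQuotient-/ x {y} {v} yv≈1 = isQuotient v yv≈1 (begin
    x            ≈⟨ *-identityʳ x ⟨
    x * 1#       ≈⟨ *-congˡ yv≈1 ⟨
    x * (y * v)  ≈⟨ solve 3 (λ x y v → x :* (y :* v) := x :* v :* y) refl x y v ⟩
    x * v * y    ∎)

  inverse-* : ∀ {y v y′ v′} → y * v ≈ 1# → y′ * v′ ≈ 1# → (y * y′) * (v * v′) ≈ 1#
  inverse-* {y} {v} {y′} {v′} yv≈1 y′v′≈1 = begin
    (y * y′) * (v * v′)
      ≈⟨ solve 4 (λ y v y′ v′ → (y :* y′) :* (v :* v′) := (y :* v) :* (y′ :* v′)) refl y v y′ v′ ⟩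
    (y * v) * (y′ * v′)  ≈⟨ *-cong yv≈1 y′v′≈1 ⟩
    1# * 1#              ≈⟨ *-identityˡ 1# ⟩
    1#                   ∎

  IsQuotient-+ : ∀ {x y a x′ y′ a′} → IsQuotient x y a → IsQuotient x′ y′ a′ →
    IsQuotient (x * y′ + x′ * y) (y * y′) (a + a′)
  IsQuotient-+ {x} {y} {a} {x′} {y′} {a′} (isQuotient v yv≈1 x≈ay) (isQuotient v′ y′v′≈1 x′≈a′y′) =
    isQuotient (v * v′) (inverse-* yv≈1 y′v′≈1) (begin
      x * y′ + x′ * y              ≈⟨ +-cong (*-congʳ x≈ay) (*-congʳ x′≈a′y′) ⟩
      a * y * y′ + a′ * y′ * y
        ≈⟨ solve 4 (λ a y a′ y′ → a :* y :* y′ :+ a′ :* y′ :* y := (a :+ a′) :* (y :* y′)) refl a y a′ y′ ⟩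
      (a + a′) * (y * y′)          ∎)

  IsQuotient-* : ∀ {x y a x′ y′ a′} → IsQuotient x y a → IsQuotient x′ y′ a′ →
    IsQuotient (x * x′) (y * y′) (a * a′)
  IsQuotient-* {x} {y} {a} {x′} {y′} {a′} (isQuotient v yv≈1 x≈ay) (isQuotient v′ y′v′≈1 x′≈a′y′) =
    isQuotient (v * v′) (inverse-* yv≈1 y′v′≈1) (begin
      x * x′                       ≈⟨ *-cong x≈ay x′≈a′y′ ⟩
      a * y * (a′ * y′)
        ≈⟨ solve 4 (λ a y a′ y′ → a :* y :* (a′ :* y′) := a :* a′ :* (y :* y′)) refl a y a′ y′ ⟩
      a * a′ * (y * y′)            ∎)

  IsQuotient-neg : ∀ {x y a} → IsQuotient x y a → IsQuotient (- x) y (- a)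
  IsQuotient-neg {x} {y} {a} (isQuotient v yv≈1 x≈ay) =
    isQuotient v yv≈1 (trans (-‿cong x≈ay) (-‿distribˡ-* a y))

  product-inverse : ∀ (f g : ℕ → Carrier) k → (∀ {j} → j ℕ.< k → f j * g j ≈ 1#) →
    product {k} (λ j → f (toℕ j)) * product {k} (λ j → g (toℕ j)) ≈ 1#
  product-inverse f g zero    fg≈1 = *-identityˡ 1#
  product-inverse f g (suc k) fg≈1 = inverse-* (fg≈1 ℕ.z<s)
    (product-inverse (λ j → f (suc j)) (λ j → g (suc j)) k λ j<k → fg≈1 (ℕ.s≤s j<k))

-- For n = 2N + 1 the number `triangular N` is (n² - 1)/8; the recursion avoids a division.
triangular : ℕ → ℕ
triangular zero    = 0
triangular (suc i) = suc i ℕ.+ triangular i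

module SumSnoc {c ℓ : Level} (M : Monoid c ℓ) where
  open Monoid M
  open import Algebra.Properties.Monoid.Sum M public using (sum)
  open import Algebra.Properties.Monoid.Sum M using (sum-init-last; sum-cong-≗)

  -- `sum` unfolds at its first index, whereas q-shifted factorials and partial sums are extended at
  -- the last one. Stated for a monoid, it serves sums and products alike.
  sum-snoc : ∀ (g : ℕ → Carrier) k →
    sum {suc k} (λ i → g (toℕ i)) ≈ sum {k} (λ i → g (toℕ i)) ∙ g k
  sum-snoc g k = trans (sum-init-last (λ i → g (toℕ i)))
    (∙-cong (reflexive (sum-cong-≗ {k} λ i → ≡.cong g (toℕ-inject₁ i)))
            (reflexive (≡.cong g (toℕ-fromℕ k))))

-- The truncated q-series

-- p is q⁻¹ and, below, u is z⁻¹.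
module QIdentity {a ℓ : Level} (K : CommutativeRing a ℓ)
  (q p : CommutativeRing.Carrier K)
  (qp≈1 : CommutativeRing._≈_ K (CommutativeRing._*_ K q p) (CommutativeRing.1# K)) where

  open CommutativeRing K hiding (zero)
  open import Algebra.Properties.Ring ring
  open import Algebra.Properties.Semiring.Exp semiring using (_^_; ^-congˡ; ^-homo-*; ^-assocʳ)
  open import Relation.Binary.Reasoning.Setoid setoid
  open RingSolver K

  -- The power x^{2j+1}, in the shape of the factors of (q;q²)ₖ.
  odd : Carrier → ℕ → Carrier
  odd x j = x * (x ^ 2) ^ j

  odd-inverse : ∀ j → odd q j * odd p j ≈ 1#
  odd-inverse zero = begin
    q * 1# * (p * 1#)  ≈⟨ solve 2 (λ q p → q :* :1 :* (p :* :1) := q :* p) refl q p ⟩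
    q * p              ≈⟨ qp≈1 ⟩
    1#                 ∎
  odd-inverse (suc j) = begin
    odd q (suc j) * odd p (suc j)
      ≈⟨ solve 4 (λ q p x y → q :* (q :^ 2 :* x) :* (p :* (p :^ 2 :* y))
           := (q :* x :* (p :* y)) :* ((q :* p) :^ 2)) refl q p ((q ^ 2) ^ j) ((p ^ 2) ^ j) ⟩
    odd q j * odd p j * (q * p) ^ 2
      ≈⟨ *-cong (odd-inverse j) (^-congˡ 2 qp≈1) ⟩
    1# * 1# ^ 2
      ≈⟨ solve 0 (:1 :* :1 :^ 2 := :1) refl ⟩
    1# ∎

  f : Carrier → Carrier → ℕ → Carrier
  f z u zero    = 1#
  f z u (suc k) = f z u k * ((1# - odd q k * z) * (1# - odd q k * u))

  f-cong : ∀ {z z′ u u′} → z ≈ z′ → u ≈ u′ → ∀ k → f z u k ≈ f z′ u′ k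
  f-cong z≈z′ u≈u′ zero    = refl
  f-cong z≈z′ u≈u′ (suc k) = *-cong (f-cong z≈z′ u≈u′ k)
    (*-cong (+-congˡ (-‿cong (*-congˡ z≈z′))) (+-congˡ (-‿cong (*-congˡ u≈u′))))

  f-sym : ∀ z u k → f z u k ≈ f u z k
  f-sym z u zero    = refl
  f-sym z u (suc k) = *-cong (f-sym z u k) (*-comm _ _)

  -- The factor with j = i contains 1 - q^{2i+1} z⁻¹, which is zero at z = q^{2i+1}. Induction along
  -- `<′` starts at the first product containing that factor.
  f-vanish : ∀ {i k} → i ℕ.<′ k → f (odd q i) (odd p i) k ≈ 0#
  f-vanish {i} ℕ.<′-base = begin
    f (odd q i) (odd p i) i * ((1# - odd q i * odd q i) * (1# - odd q i * odd p i))
      ≈⟨ *-congˡ (*-congˡ (+-congˡ (-‿cong (odd-inverse i)))) ⟩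
    f (odd q i) (odd p i) i * ((1# - odd q i * odd q i) * (1# - 1#))
      ≈⟨ solve 2 (λ x y → x :* (y :* (:1 :- :1)) := con (+ 0)) refl _ _ ⟩
    0# ∎
  f-vanish (ℕ.≤′-step i<k) = trans (*-congʳ (f-vanish i<k)) (zeroˡ _)

  -- Certifies, by means of the cofactors a and b, an identity modulo the ideal (s, t); in the
  -- applications s and t are qp - 1 and zu - 1.
  relations : ∀ {x y s t} a b → x ≈ y + (a * s + b * t) → s ≈ 0# → t ≈ 0# → x ≈ y
  relations {x} {y} {s} {t} a b e s≈0 t≈0 = begin
    x                     ≈⟨ e ⟩
    y + (a * s + b * t)   ≈⟨ +-congˡ (+-cong (*-congˡ s≈0) (*-congˡ t≈0)) ⟩
    y + (a * 0# + b * 0#) ≈⟨ solve 3 (λ y a b → y :+ (a :* con (+ 0) :+ b :* con (+ 0)) := y)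
                               refl y a b ⟩
    y                     ∎

  x≈1⇒x-1≈0 : ∀ {x} → x ≈ 1# → x - 1# ≈ 0#
  x≈1⇒x-1≈0 x≈1 = trans (+-congʳ x≈1) (-‿inverseʳ 1#)

  qp-1≈0 : q * p - 1# ≈ 0#
  qp-1≈0 = x≈1⇒x-1≈0 qp≈1

  -- Compared with f_k(z), the product f_{k+1}(q² z) lacks the factor 1 - q z, has 1 - q^{2k+1} z
  -- and 1 - q^{2k+3} z in addition, and starts its second half with the new factor 1 - u/q. As z u
  -- = 1, this last one equals -(u/q)(1 - q z) and restores what is lacking.
  f-shift : ∀ z u → z * u ≈ 1# → ∀ k →
    f (q ^ 2 * z) (p ^ 2 * u) (suc k) ≈
    - (u * p) * f z u k * ((1# - odd q k * z) * (1# - odd q (suc k) * z))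
  f-shift z u zu≈1 zero = relations
    (- (p * u * (1# - q ^ 3 * z))  + u * z * - (1# - q ^ 3 * z)) (- (1# - q ^ 3 * z))
    (solve 4 (λ q p z u →
      :1 :* ((:1 :- (q :* :1) :* (q :^ 2 :* z)) :* (:1 :- (q :* :1) :* (p :^ 2 :* u)))
      := :- (u :* p) :* :1 :* ((:1 :- (q :* :1) :* z) :* (:1 :- q :* (q :^ 2 :* :1) :* z))
         :+ ((:- (p :* u :* (:1 :- q :^ 3 :* z)) :+ u :* z :* :- (:1 :- q :^ 3 :* z)) :* (q :* p :- :1)
             :+ (:- (:1 :- q :^ 3 :* z)) :* (z :* u :- :1)))
      refl q p z u)
    qp-1≈0 (x≈1⇒x-1≈0 zu≈1)
  -- Only q³ c p² u has to be simplified to q c u. The difference is q c u (q² p² - 1), whence the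
  -- cofactor `q * p + 1#`; the second relation is filled in with coefficient 0.
  f-shift z u zu≈1 (suc k) = trans (*-congʳ (f-shift z u zu≈1 k)) (relations
    (- (u * p) * F * ((1# - q * c * z) * (1# - q * (q ^ 2 * c) * z))
      * ((1# - q * (q ^ 2 * c) * (q ^ 2 * z)) * (- (u * q * c) * (q * p + 1#)))) 0#
    (solve 6 (λ q p z u c F →
      :- (u :* p) :* F :* ((:1 :- q :* c :* z) :* (:1 :- q :* (q :^ 2 :* c) :* z))
        :* ((:1 :- q :* (q :^ 2 :* c) :* (q :^ 2 :* z)) :* (:1 :- q :* (q :^ 2 :* c) :* (p :^ 2 :* u)))
      := :- (u :* p) :* (F :* ((:1 :- q :* c :* z) :* (:1 :- q :* c :* u)))
         :* ((:1 :- q :* (q :^ 2 :* c) :* z) :* (:1 :- q :* (q :^ 2 :* (q :^ 2 :* c)) :* z))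
         :+ ((:- (u :* p) :* F :* ((:1 :- q :* c :* z) :* (:1 :- q :* (q :^ 2 :* c) :* z))
              :* ((:1 :- q :* (q :^ 2 :* c) :* (q :^ 2 :* z)) :* (:- (u :* q :* c) :* (q :* p :+ :1))))
             :* (q :* p :- :1) :+ con (+ 0) :* (q :* p :- :1)))
      refl q p z u c F)
    qp-1≈0 qp-1≈0)
    where
    c = (q ^ 2) ^ k
    F = f z u k

  quad : ℕ → Carrier
  quad j = q ^ 4 * (q ^ 4) ^ j

  -- Makes the telescoping step polynomial in c = q^{2j}, as the solver requires.
  quad≈ : ∀ j → quad j ≈ q ^ 4 * ((q ^ 2) ^ j) ^ 2
  quad≈ j = *-congˡ (begin
    (q ^ 4) ^ j        ≈⟨ ^-assocʳ q 4 j ⟩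
    q ^ (4 ℕ.* j)      ≡⟨ ≡.cong (q ^_) (exponents j) ⟩
    q ^ (2 ℕ.* j ℕ.* 2)  ≈⟨ ^-assocʳ q (2 ℕ.* j) 2 ⟨
    (q ^ (2 ℕ.* j)) ^ 2  ≈⟨ ^-congˡ 2 (^-assocʳ q 2 j) ⟨
    ((q ^ 2) ^ j) ^ 2  ∎)
    where
    exponents : ∀ j → 4 ℕ.* j ≡ 2 ℕ.* j ℕ.* 2
    exponents = solve-∀

  q^[1+k]² : ∀ k → q ^ (suc k ℕ.^ 2) ≈ q ^ (k ℕ.^ 2) * odd q k
  q^[1+k]² k = begin
    q ^ (suc k ℕ.^ 2)                     ≡⟨ ≡.cong (q ^_) (exponents k) ⟩
    q ^ (k ℕ.^ 2 ℕ.+ suc (2 ℕ.* k))       ≈⟨ ^-homo-* q (k ℕ.^ 2) (suc (2 ℕ.* k)) ⟩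
    q ^ (k ℕ.^ 2) * (q * q ^ (2 ℕ.* k))   ≈⟨ *-congˡ (*-congˡ (^-assocʳ q 2 k)) ⟨
    q ^ (k ℕ.^ 2) * odd q k               ∎
    where
    exponents : ∀ k → suc k ℕ.* (suc k ℕ.* 1) ≡ k ℕ.* (k ℕ.* 1) ℕ.+ suc (2 ℕ.* k)
    exponents = solve-∀

  -- Inverses are required only below `N`: in the application 1 - `odd q N` is 1 - qⁿ, whose square
  -- is zero.
  module _ (N : ℕ) (r s : ℕ → Carrier)
    (r-inverse : ∀ {j} → j ℕ.< N → (1# - odd q j) * r j ≈ 1#)
    (s-inverse : ∀ {j} → j ℕ.< N → (1# - quad j) * s j ≈ 1#) where

    -- 1 / ((q;q²)ₖ (q⁴;q⁴)ₖ)
    E : ℕ → Carrier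
    E zero    = 1#
    E (suc k) = E k * (r k * s k)

    t : Carrier → Carrier → ℕ → Carrier
    t z u k = q ^ (k ℕ.^ 2) * f z u k * E k

    t-cong : ∀ {z z′ u u′} → z ≈ z′ → u ≈ u′ → ∀ k → t z u k ≈ t z′ u′ k
    t-cong z≈z′ u≈u′ k = *-congʳ (*-congˡ (f-cong z≈z′ u≈u′ k))

    t-sym : ∀ z u k → t z u k ≈ t u z k
    t-sym z u k = *-congʳ (*-congˡ (f-sym z u k))

    t-vanish : ∀ {i k} → i ℕ.<′ k → t (odd q i) (odd p i) k ≈ 0#
    t-vanish i<k = trans (*-congʳ (trans (*-congˡ (f-vanish i<k)) (zeroʳ _))) (zeroˡ _)

    S : Carrier → Carrier → ℕ → Carrier
    S z u zero    = t z u zero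
    S z u (suc k) = S z u k + t z u (suc k)

    S-cong : ∀ {z z′ u u′} → z ≈ z′ → u ≈ u′ → ∀ k → S z u k ≈ S z′ u′ k
    S-cong z≈z′ u≈u′ zero    = t-cong z≈z′ u≈u′ zero
    S-cong z≈z′ u≈u′ (suc k) = +-cong (S-cong z≈z′ u≈u′ k) (t-cong z≈z′ u≈u′ (suc k))

    S-sym : ∀ z u k → S z u k ≈ S u z k
    S-sym z u zero    = t-sym z u zero
    S-sym z u (suc k) = +-cong (S-sym z u k) (t-sym z u (suc k))

    telescope : ∀ z u → z * u ≈ 1# → ∀ {k} → k ℕ.≤ N →
      S (q ^ 2 * z) (p ^ 2 * u) k + u * S (p ^ 2 * z) (q ^ 2 * u) k ≈
      (1# + u) * (q ^ 2) ^ k * t z u k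
    telescope z u zu≈1 {zero} _ =
      solve 1 (λ u → :1 :* :1 :* :1 :+ u :* (:1 :* :1 :* :1)
                     := (:1 :+ u) :* :1 :* (:1 :* :1 :* :1)) refl u
    telescope z u zu≈1 {suc k} k<N = begin
      (S₁ + t₁) + u * (S₂ + t₂)
        ≈⟨ solve 5 (λ u S₁ t₁ S₂ t₂ → (S₁ :+ t₁) :+ u :* (S₂ :+ t₂)
             := (S₁ :+ u :* S₂) :+ (t₁ :+ u :* t₂)) refl u S₁ t₁ S₂ t₂ ⟩
      (S₁ + u * S₂) + (t₁ + u * t₂)
        ≈⟨ +-cong (trans (telescope z u zu≈1 (ℕ.<⇒≤ k<N)) (trans (sym (*-identityʳ _)) (*-congˡ units)))
             (+-cong t₁≈ (*-congˡ t₂≈)) ⟩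
      (1# + u) * c * (Q * F * E k) * (((1# - q * c) * r k) * ((1# - q ^ 4 * c ^ 2) * s k))
        + (Q * (q * c) * (- (u * p) * F * ((1# - q * c * z) * (1# - q * (q ^ 2 * c) * z)))
             * (E k * (r k * s k))
           + u * (Q * (q * c) * (- (z * p) * F * ((1# - q * c * u) * (1# - q * (q ^ 2 * c) * u)))
             * (E k * (r k * s k))))
        ≈⟨ solve 10 (λ q p z u c Q F E r s →
             (:1 :+ u) :* c :* (Q :* F :* E)
               :* (((:1 :- q :* c) :* r) :* ((:1 :- q :^ 4 :* c :^ 2) :* s))
             :+ (Q :* (q :* c)
                  :* (:- (u :* p) :* F :* ((:1 :- q :* c :* z) :* (:1 :- q :* (q :^ 2 :* c) :* z)))
                  :* (E :* (r :* s))
                :+ u :* (Q :* (q :* c)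
                  :* (:- (z :* p) :* F :* ((:1 :- q :* c :* u) :* (:1 :- q :* (q :^ 2 :* c) :* u)))
                  :* (E :* (r :* s))))
             := (Q :* F :* (E :* (r :* s))) :* L q p z u c) refl q p z u c Q F (E k) (r k) (s k) ⟩
      Q * F * (E k * (r k * s k)) *
        ((1# + u) * c * (1# - q * c) * (1# - q ^ 4 * c ^ 2)
         + q * c * (- (u * p) * ((1# - q * c * z) * (1# - q * (q ^ 2 * c) * z))
                    + u * (- (z * p) * ((1# - q * c * u) * (1# - q * (q ^ 2 * c) * u)))))
        -- The first cofactor arises from replacing `q * p` by 1 in the two terms that contain `p`,
        -- the second from replacing `z * u` by 1 in what is left.
        ≈⟨ *-congˡ (relations
             (c * (- u * ((1# - q * c * z) * (1# - q ^ 3 * c * z))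
                   - u * z * ((1# - q * c * u) * (1# - q ^ 3 * c * u))))
             (c * (q * c * (1# + q ^ 2) - z * q ^ 4 * c ^ 2
                   - (1# - q * c * (1# + q ^ 2) * u + q ^ 4 * c ^ 2 * u ^ 2)
                   - (1# + u) * q ^ 5 * c ^ 3 + q ^ 4 * c ^ 2))
             (solve 5 (λ q p z u c → L q p z u c
               := (:1 :+ u) :* (q :^ 2 :* c) :* (q :* c) :* ((:1 :- q :* c :* z) :* (:1 :- q :* c :* u))
                  :+ (c :* (:- u :* ((:1 :- q :* c :* z) :* (:1 :- q :^ 3 :* c :* z))
                            :- u :* z :* ((:1 :- q :* c :* u) :* (:1 :- q :^ 3 :* c :* u)))
                       :* (q :* p :- :1)
                     :+ c :* (q :* c :* (:1 :+ q :^ 2) :- z :* q :^ 4 :* c :^ 2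
                            :- (:1 :- q :* c :* (:1 :+ q :^ 2) :* u :+ q :^ 4 :* c :^ 2 :* u :^ 2)
                            :- (:1 :+ u) :* q :^ 5 :* c :^ 3 :+ q :^ 4 :* c :^ 2)
                       :* (z :* u :- :1)))
               refl q p z u c)
             qp-1≈0 (x≈1⇒x-1≈0 zu≈1)) ⟩
      Q * F * (E k * (r k * s k)) *
        ((1# + u) * (q ^ 2 * c) * (q * c) * ((1# - q * c * z) * (1# - q * c * u)))
        ≈⟨ solve 8 (λ q z u c Q F E G →
             Q :* F :* E :* ((:1 :+ u) :* (q :^ 2 :* c) :* (q :* c) :* G)
             := (:1 :+ u) :* (q :^ 2 :* c) :* (Q :* (q :* c) :* (F :* G) :* E))
             refl q z u c Q F (E (suc k)) ((1# - q * c * z) * (1# - q * c * u)) ⟩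
      (1# + u) * (q ^ 2 * c) * (Q * (q * c) * (F * ((1# - q * c * z) * (1# - q * c * u))) * E (suc k))
        ≈⟨ *-congˡ (*-congʳ (*-congʳ (q^[1+k]² k))) ⟨
      (1# + u) * (q ^ 2) ^ suc k * t z u (suc k) ∎
      where
      c = (q ^ 2) ^ k
      Q = q ^ (k ℕ.^ 2)
      F = f z u k
      S₁ = S (q ^ 2 * z) (p ^ 2 * u) k
      S₂ = S (p ^ 2 * z) (q ^ 2 * u) k
      t₁ = t (q ^ 2 * z) (p ^ 2 * u) (suc k)
      t₂ = t (p ^ 2 * z) (q ^ 2 * u) (suc k)
      -- What remains of the induction step once the common factor `Q * F * E (suc k)` has been
      -- taken out.
      L : ∀ {n} → (q p z u c : Polynomial n) → Polynomial n
      L q p z u c =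
        (:1 :+ u) :* c :* (:1 :- q :* c) :* (:1 :- q :^ 4 :* c :^ 2)
        :+ q :* c :* (:- (u :* p) :* ((:1 :- q :* c :* z) :* (:1 :- q :* (q :^ 2 :* c) :* z))
                    :+ u :* (:- (z :* p) :* ((:1 :- q :* c :* u) :* (:1 :- q :* (q :^ 2 :* c) :* u))))
      -- Multiplied onto the earlier partial sum, this brings it to the denominator `E (suc k)` of
      -- the new summands.
      units : 1# ≈ ((1# - q * c) * r k) * ((1# - q ^ 4 * c ^ 2) * s k)
      units = begin
        1#         ≈⟨ *-identityˡ 1# ⟨
        1# * 1#    ≈⟨ *-cong (r-inverse k<N)
                        (trans (*-congʳ (+-congˡ (-‿cong (sym (quad≈ k))))) (s-inverse k<N)) ⟨
        ((1# - q * c) * r k) * ((1# - q ^ 4 * c ^ 2) * s k) ∎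
      t₁≈ : t₁ ≈ Q * (q * c) * (- (u * p) * F * ((1# - q * c * z) * (1# - q * (q ^ 2 * c) * z)))
                 * (E k * (r k * s k))
      t₁≈ = *-congʳ (*-cong (q^[1+k]² k) (f-shift z u zu≈1 k))
      t₂≈ : t₂ ≈ Q * (q * c) * (- (z * p) * F * ((1# - q * c * u) * (1# - q * (q ^ 2 * c) * u)))
                 * (E k * (r k * s k))
      -- Dividing z by q² multiplies z⁻¹ by q², so the symmetry of `f` reduces this to the same
      -- shift with z and u exchanged.
      t₂≈ = *-congʳ (*-cong (q^[1+k]² k) (begin
        f (p ^ 2 * z) (q ^ 2 * u) (suc k)
          ≈⟨ f-sym (p ^ 2 * z) (q ^ 2 * u) (suc k) ⟩
        f (q ^ 2 * u) (p ^ 2 * z) (suc k)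
          ≈⟨ f-shift u z (trans (*-comm u z) zu≈1) k ⟩
        - (z * p) * f u z k * ((1# - q * c * u) * (1# - q * (q ^ 2 * c) * u))
          ≈⟨ *-congʳ (*-congˡ (f-sym u z k)) ⟩
        - (z * p) * F * ((1# - q * c * u) * (1# - q * (q ^ 2 * c) * u)) ∎))

    S-recurrence : ∀ {i} → suc i ℕ.< N →
      S (odd q (2 ℕ.+ i)) (odd p (2 ℕ.+ i)) N ≈ - odd p (suc i) * S (odd q i) (odd p i) N
    S-recurrence {i} 1+i<N = begin
      S (odd q (2 ℕ.+ i)) (odd p (2 ℕ.+ i)) N
        ≈⟨ S-cong (shift-up q) (shift-up p) N ⟩
      S (q ^ 2 * z) (p ^ 2 * u) N
        ≈⟨ solve 2 (λ x y → x := (x :+ y) :- y) refl _ _ ⟩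
      (S (q ^ 2 * z) (p ^ 2 * u) N + u * S (p ^ 2 * z) (q ^ 2 * u) N) - u * S (p ^ 2 * z) (q ^ 2 * u) N
        -- At z = q^{2i+3} the summand with index N vanishes, because i + 1 < N puts the factor j =
        -- i + 1 into f_N.
        ≈⟨ +-cong (trans (telescope z u (odd-inverse (suc i)) ℕ.≤-refl)
                         (trans (*-congˡ (t-vanish (ℕ.<⇒<′ 1+i<N))) (zeroʳ _)))
                  (-‿cong (*-congˡ (S-cong (shift-down pq≈1) (shift-down qp≈1) N))) ⟩
      0# - u * S (odd q i) (odd p i) N
        ≈⟨ solve 2 (λ x y → con (+ 0) :- x :* y := :- x :* y) refl _ _ ⟩
      - u * S (odd q i) (odd p i) N ∎
      where
      z = odd q (suc i)
      u = odd p (suc i)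
      pq≈1 = trans (*-comm p q) qp≈1
      shift-up : ∀ x → odd x (2 ℕ.+ i) ≈ x ^ 2 * odd x (suc i)
      shift-up x = solve 2 (λ x y → x :* (x :^ 2 :* y) := x :^ 2 :* (x :* y)) refl x _
      shift-down : ∀ {x y} → y * x ≈ 1# → y ^ 2 * odd x (suc i) ≈ odd x i
      shift-down {x} {y} yx≈1 = begin
        y ^ 2 * odd x (suc i)
          ≈⟨ solve 3 (λ x y w → y :^ 2 :* (x :* (x :^ 2 :* w)) := (y :* x) :^ 2 :* (x :* w)) refl x y _ ⟩
        (y * x) ^ 2 * odd x i
          ≈⟨ *-congʳ (^-congˡ 2 yx≈1) ⟩
        1# ^ 2 * odd x i
          ≈⟨ solve 1 (λ x → :1 :^ 2 :* x := x) refl _ ⟩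
        odd x i ∎

    S₀ : ∀ k → S (odd q 0) (odd p 0) k ≈ 1#
    S₀ zero    = solve 0 (:1 :* :1 :* :1 := :1) refl
    S₀ (suc k) = trans (+-cong (S₀ k) (t-vanish (ℕ.<⇒<′ ℕ.z<s))) (+-identityʳ 1#)

    -- The downward shift of z = q is z = 1/q, which is outside the family `odd q i`. Symmetry in z
    -- and 1/z turns the value there into `S₀`.
    S₁ : 0 ℕ.< N → S (odd q 1) (odd p 1) N ≈ - p
    S₁ 0<N = begin
      S (odd q 1) (odd p 1) N
        ≈⟨ S-cong (shift q) (shift p) N ⟩
      S (q ^ 2 * odd q 0) (p ^ 2 * odd p 0) N
        ≈⟨ solve 2 (λ x y → x := (x :+ y) :- y) refl _ _ ⟩
      (S (q ^ 2 * odd q 0) (p ^ 2 * odd p 0) N + odd p 0 * S (p ^ 2 * odd q 0) (q ^ 2 * odd p 0) N)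
        - odd p 0 * S (p ^ 2 * odd q 0) (q ^ 2 * odd p 0) N
        ≈⟨ +-cong (trans (telescope (odd q 0) (odd p 0) (odd-inverse 0) ℕ.≤-refl)
                         (trans (*-congˡ (t-vanish (ℕ.<⇒<′ 0<N))) (zeroʳ _)))
                  (-‿cong (*-congˡ (trans
                    (trans (S-sym (p ^ 2 * odd q 0) (q ^ 2 * odd p 0) N)
                           (S-cong (cancel qp≈1) (cancel (trans (*-comm p q) qp≈1)) N))
                    (S₀ N)))) ⟩
      0# - odd p 0 * 1#
        ≈⟨ solve 1 (λ p → con (+ 0) :- p :* :1 :* :1 := :- p) refl p ⟩
      - p ∎
      where
      shift : ∀ x → odd x 1 ≈ x ^ 2 * odd x 0
      shift x = solve 1 (λ x → x :* (x :^ 2 :* :1) := x :^ 2 :* (x :* :1)) refl x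
      cancel : ∀ {x y} → y * x ≈ 1# → y ^ 2 * odd x 0 ≈ odd y 0
      cancel {x} {y} yx≈1 = begin
        y ^ 2 * odd x 0  ≈⟨ solve 2 (λ x y → y :^ 2 :* (x :* :1) := (y :* x) :* (y :* :1)) refl x y ⟩
        y * x * odd y 0  ≈⟨ *-congʳ yx≈1 ⟩
        1# * odd y 0     ≈⟨ *-identityˡ _ ⟩
        odd y 0          ∎

    -- The recurrence advances i by two, so both `S₀` and `S₁` serve as base cases. The exponents
    -- agree because triangular numbers two apart differ by 2i + 3.
    S-evaluation : ∀ i → i ℕ.≤ N → S (odd q i) (odd p i) N ≈ (- p) ^ triangular i
    S-evaluation 0             _   = S₀ N
    S-evaluation 1             1≤N = trans (S₁ 1≤N) (sym (*-identityʳ (- p)))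
    S-evaluation (suc (suc i)) i≤N = begin
      S (odd q (2 ℕ.+ i)) (odd p (2 ℕ.+ i)) N
        ≈⟨ S-recurrence i≤N ⟩
      - odd p (suc i) * S (odd q i) (odd p i) N
        ≈⟨ *-congˡ (S-evaluation i (ℕ.≤-trans (ℕ.m≤n+m i 2) i≤N)) ⟩
      - odd p (suc i) * (- p) ^ triangular i
        ≈⟨ *-congʳ odd-power ⟩
      (- p) ^ (suc (2 ℕ.* suc i)) * (- p) ^ triangular i
        ≈⟨ ^-homo-* (- p) (suc (2 ℕ.* suc i)) (triangular i) ⟨
      (- p) ^ (suc (2 ℕ.* suc i) ℕ.+ triangular i)
        ≡⟨ ≡.cong ((- p) ^_) (exponents i (triangular i)) ⟩
      (- p) ^ triangular (suc (suc i)) ∎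
      where
      exponents : ∀ i x → suc (2 ℕ.* suc i) ℕ.+ x ≡ suc (suc i) ℕ.+ (suc i ℕ.+ x)
      exponents = solve-∀
      -- The exponent 2i + 3 is odd, so the sign can be absorbed into the base.
      odd-power : - odd p (suc i) ≈ (- p) ^ (suc (2 ℕ.* suc i))
      odd-power = begin
        - (p * (p ^ 2) ^ suc i)          ≈⟨ -‿distribˡ-* p _ ⟩
        - p * (p ^ 2) ^ suc i
          ≈⟨ *-congˡ (^-congˡ (suc i) (solve 1 (λ p → p :^ 2 := (:- p) :^ 2) refl p)) ⟩
        - p * ((- p) ^ 2) ^ suc i        ≈⟨ *-congˡ (^-assocʳ (- p) 2 (suc i)) ⟩
        - p * (- p) ^ (2 ℕ.* suc i)      ∎

    open SumSnoc *-monoid renaming (sum to product; sum-snoc to product-snoc)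
    open SumSnoc +-monoid

    f-square : (1# - odd q N) ^ 2 ≈ 0# → ∀ k →
      f (odd q N) (odd p N) k ≈ product {k} (λ j → 1# - odd q (toℕ j)) ^ 2
    f-square [1-z]²≈0 zero    = solve 0 (:1 := :1 :^ 2) refl
    f-square [1-z]²≈0 (suc k) = begin
      f z u k * ((1# - o * z) * (1# - o * u))
        -- For z u = 1 one has exactly (1 - o z)(1 - o u) = (1 - o)² - o u (1 - z)².
        ≈⟨ *-cong (f-square [1-z]²≈0 k) (relations (- (o * u)) (o ^ 2 + - (1# + 1#) * o + o * z)
             (solve 3 (λ o z u → (:1 :- o :* z) :* (:1 :- o :* u)
               := (:1 :- o) :^ 2 :+ (:- (o :* u) :* (:1 :- z) :^ 2
                    :+ (o :^ 2 :+ (:- (:1 :+ :1)) :* o :+ o :* z) :* (z :* u :- :1))) refl o z u)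
             [1-z]²≈0 (x≈1⇒x-1≈0 (odd-inverse N))) ⟩
      product {k} (λ j → 1# - odd q (toℕ j)) ^ 2 * (1# - o) ^ 2
        ≈⟨ solve 2 (λ x y → x :^ 2 :* y :^ 2 := (x :* y) :^ 2) refl _ _ ⟩
      (product {k} (λ j → 1# - odd q (toℕ j)) * (1# - o)) ^ 2
        ≈⟨ ^-congˡ 2 (product-snoc (λ j → 1# - odd q j) k) ⟨
      product {suc k} (λ j → 1# - odd q (toℕ j)) ^ 2 ∎
      where
      z = odd q N
      u = odd p N
      o = odd q k

    -- Of the two copies of (q;q²)ₖ that `f-square` produces, one cancels against the denominator
    -- `E k`.
    product*E : ∀ {k} → k ℕ.≤ N →
      product {k} (λ j → 1# - odd q (toℕ j)) * E k ≈ product {k} (λ j → s (toℕ j))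
    product*E {zero}  _   = *-identityˡ 1#
    product*E {suc k} k<N = begin
      product {suc k} (λ j → 1# - odd q (toℕ j)) * (E k * (r k * s k))
        ≈⟨ *-congʳ (product-snoc (λ j → 1# - odd q j) k) ⟩
      product {k} (λ j → 1# - odd q (toℕ j)) * (1# - odd q k) * (E k * (r k * s k))
        ≈⟨ solve 5 (λ a o e r s → a :* o :* (e :* (r :* s)) := (a :* e) :* (o :* r) :* s) refl _ _ _ _ _ ⟩
      (product {k} (λ j → 1# - odd q (toℕ j)) * E k) * ((1# - odd q k) * r k) * s k
        ≈⟨ *-congʳ (*-cong (product*E (ℕ.<⇒≤ k<N)) (r-inverse k<N)) ⟩
      product {k} (λ j → s (toℕ j)) * 1# * s k
        ≈⟨ *-congʳ (*-identityʳ _) ⟩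
      product {k} (λ j → s (toℕ j)) * s k
        ≈⟨ product-snoc s k ⟨
      product {suc k} (λ j → s (toℕ j)) ∎

    term : ℕ → Carrier
    term k = q ^ (k ℕ.^ 2) *
      (product {k} (λ j → 1# - odd q (toℕ j)) * product {k} (λ j → s (toℕ j)))

    module _ ([1-z]²≈0 : (1# - odd q N) ^ 2 ≈ 0#) where

      t≈term : ∀ {k} → k ℕ.≤ N → t (odd q N) (odd p N) k ≈ term k
      t≈term {k} k≤N = begin
        q ^ (k ℕ.^ 2) * f (odd q N) (odd p N) k * E k
          ≈⟨ *-congʳ (*-congˡ (f-square [1-z]²≈0 k)) ⟩
        q ^ (k ℕ.^ 2) * A ^ 2 * E k
          ≈⟨ solve 3 (λ x a e → x :* a :^ 2 :* e := x :* (a :* (a :* e))) refl _ A (E k) ⟩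
        q ^ (k ℕ.^ 2) * (A * (A * E k))
          ≈⟨ *-congˡ (*-congˡ (product*E k≤N)) ⟩
        term k ∎
        where A = product {k} (λ j → 1# - odd q (toℕ j))

      S≈sum : ∀ {k} → k ℕ.≤ N → S (odd q N) (odd p N) k ≈ sum {suc k} (λ i → term (toℕ i))
      S≈sum {zero}  k≤N = trans (t≈term k≤N) (sym (+-identityʳ _))
      S≈sum {suc k} k≤N = trans (+-cong (S≈sum (ℕ.<⇒≤ k≤N)) (t≈term k≤N))
                                (sym (sum-snoc term (suc k)))

      truncated-sum : sum {suc N} (λ k → term (toℕ k)) ≈ (- p) ^ triangular N
      truncated-sum = trans (sym (S≈sum ℕ.≤-refl)) (S-evaluation N ℕ.≤-refl)

-- Polynomials over ℚ

ℚ[q]-commutativeRing : CommutativeRing 0ℓ 0ℓ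
ℚ[q]-commutativeRing = record
  { Carrier = ℚ[q]
  ; _≈_ = P._≈_
  ; _+_ = P._+_
  ; _*_ = P._*_
  ; -_  = P.-_
  ; 0#  = P.0#
  ; 1#  = P.1#
  ; isCommutativeRing = record
    { isRing = record
      { +-isAbelianGroup = record
        { isGroup = record
          { isMonoid = record
            { isSemigroup = record
              { isMagma = record
                { isEquivalence = record { refl = refl ; sym = sym ; trans = trans }
                ; ∙-cong = +-cong
                }
              ; assoc = +-assoc
              }
            ; identity = (λ f → refl) , +-identityʳ
            }
          ; inverse = (λ f → trans (+-comm (P.- f) f) (+-inverseʳ f)) , +-inverseʳ
          ; ⁻¹-cong = -‿cong
          }
        ; comm = +-comm
        }
      ; *-cong = λ {f} {f′} {g} {g′} f≈f′ g≈g′ →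
          trans (*-congʳ f f′ g f≈f′) (*-congˡ f′ g≈g′)
      ; *-assoc = *-assoc
      ; *-identity = *-identityˡ , λ f → trans (*-comm f P.1#) (*-identityˡ f)
      ; distrib = (λ f g h → distribˡ f g h) , λ f g h → distribʳ f g h
      }
    ; *-comm = *-comm
    }
  }
  where
  open P using (_≈_; _+_; _*_; _·_; coeff-+; coeff--; coeff-·; coeff-∷*)
  open ≡.≡-Reasoning

  refl : ∀ {f} → f ≈ f
  refl .coeff≡ _ = ≡.refl

  sym : ∀ {f g} → f ≈ g → g ≈ f
  sym f≈g .coeff≡ i = ≡.sym (f≈g .coeff≡ i)

  trans : ∀ {f g h} → f ≈ g → g ≈ h → f ≈ h
  trans f≈g g≈h .coeff≡ i = ≡.trans (f≈g .coeff≡ i) (g≈h .coeff≡ i)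

  +-cong : ∀ {f f′ g g′} → f ≈ f′ → g ≈ g′ → f + g ≈ f′ + g′
  +-cong {f} {f′} {g} {g′} f≈f′ g≈g′ .coeff≡ i = begin
    coeff (f + g) i             ≡⟨ coeff-+ f g i ⟩
    coeff f i ℚ.+ coeff g i     ≡⟨ ≡.cong₂ ℚ._+_ (f≈f′ .coeff≡ i) (g≈g′ .coeff≡ i) ⟩
    coeff f′ i ℚ.+ coeff g′ i   ≡⟨ coeff-+ f′ g′ i ⟨
    coeff (f′ + g′) i           ∎

  +-assoc : ∀ f g h → (f + g) + h ≈ f + (g + h)
  +-assoc f g h .coeff≡ i = begin
    coeff ((f + g) + h) i                       ≡⟨ coeff-+ (f + g) h i ⟩
    coeff (f + g) i ℚ.+ coeff h i               ≡⟨ ≡.cong (ℚ._+ coeff h i) (coeff-+ f g i) ⟩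
    (coeff f i ℚ.+ coeff g i) ℚ.+ coeff h i     ≡⟨ ℚ.+-assoc (coeff f i) (coeff g i) (coeff h i) ⟩
    coeff f i ℚ.+ (coeff g i ℚ.+ coeff h i)     ≡⟨ ≡.cong (coeff f i ℚ.+_) (coeff-+ g h i) ⟨
    coeff f i ℚ.+ coeff (g + h) i               ≡⟨ coeff-+ f (g + h) i ⟨
    coeff (f + (g + h)) i                       ∎

  +-comm : ∀ f g → f + g ≈ g + f
  +-comm f g .coeff≡ i = begin
    coeff (f + g) i           ≡⟨ coeff-+ f g i ⟩
    coeff f i ℚ.+ coeff g i   ≡⟨ ℚ.+-comm (coeff f i) (coeff g i) ⟩
    coeff g i ℚ.+ coeff f i   ≡⟨ coeff-+ g f i ⟨
    coeff (g + f) i           ∎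

  +-identityʳ : ∀ f → f + [] ≈ f
  +-identityʳ f = +-comm f []

  +-inverseʳ : ∀ f → f + P.- f ≈ []
  +-inverseʳ f .coeff≡ i = begin
    coeff (f + P.- f) i               ≡⟨ coeff-+ f (P.- f) i ⟩
    coeff f i ℚ.+ coeff (P.- f) i     ≡⟨ ≡.cong (coeff f i ℚ.+_) (coeff-- f i) ⟩
    coeff f i ℚ.+ ℚ.- coeff f i       ≡⟨ ℚ.+-inverseʳ (coeff f i) ⟩
    0ℚ                                ∎

  -‿cong : ∀ {f g} → f ≈ g → P.- f ≈ P.- g
  -‿cong {f} {g} f≈g .coeff≡ i = begin
    coeff (P.- f) i   ≡⟨ coeff-- f i ⟩
    ℚ.- coeff f i     ≡⟨ ≡.cong ℚ.-_ (f≈g .coeff≡ i) ⟩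
    ℚ.- coeff g i     ≡⟨ coeff-- g i ⟨
    coeff (P.- g) i   ∎

  ∷-cong : ∀ {a b f g} → a ≡ b → f ≈ g → (a ∷ f) ≈ (b ∷ g)
  ∷-cong a≡b f≈g .coeff≡ zero    = a≡b
  ∷-cong a≡b f≈g .coeff≡ (suc i) = f≈g .coeff≡ i

  ·-congˡ : ∀ a {f g} → f ≈ g → a · f ≈ a · g
  ·-congˡ a {f} {g} f≈g .coeff≡ i = begin
    coeff (a · f) i     ≡⟨ coeff-· a f i ⟩
    a ℚ.* coeff f i     ≡⟨ ≡.cong (a ℚ.*_) (f≈g .coeff≡ i) ⟩
    a ℚ.* coeff g i     ≡⟨ coeff-· a g i ⟨
    coeff (a · g) i     ∎

  ·-congʳ : ∀ {a b} f → a ≡ b → a · f ≈ b · f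
  ·-congʳ f ≡.refl = refl

  0·f≈0 : ∀ f → 0ℚ · f ≈ []
  0·f≈0 f .coeff≡ i = ≡.trans (coeff-· 0ℚ f i) (ℚ.*-zeroˡ (coeff f i))

  ·-distribˡ : ∀ a f g → a · (f + g) ≈ a · f + a · g
  ·-distribˡ a f g .coeff≡ i = begin
    coeff (a · (f + g)) i                   ≡⟨ coeff-· a (f + g) i ⟩
    a ℚ.* coeff (f + g) i                   ≡⟨ ≡.cong (a ℚ.*_) (coeff-+ f g i) ⟩
    a ℚ.* (coeff f i ℚ.+ coeff g i)         ≡⟨ ℚ.*-distribˡ-+ a (coeff f i) (coeff g i) ⟩
    a ℚ.* coeff f i ℚ.+ a ℚ.* coeff g i     ≡⟨ ≡.cong₂ ℚ._+_ (coeff-· a f i) (coeff-· a g i) ⟨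
    coeff (a · f) i ℚ.+ coeff (a · g) i     ≡⟨ coeff-+ (a · f) (a · g) i ⟨
    coeff (a · f + a · g) i                 ∎

  ·-distribʳ : ∀ a b f → (a ℚ.+ b) · f ≈ a · f + b · f
  ·-distribʳ a b f .coeff≡ i = begin
    coeff ((a ℚ.+ b) · f) i                 ≡⟨ coeff-· (a ℚ.+ b) f i ⟩
    (a ℚ.+ b) ℚ.* coeff f i                 ≡⟨ ℚ.*-distribʳ-+ (coeff f i) a b ⟩
    a ℚ.* coeff f i ℚ.+ b ℚ.* coeff f i     ≡⟨ ≡.cong₂ ℚ._+_ (coeff-· a f i) (coeff-· b f i) ⟨
    coeff (a · f) i ℚ.+ coeff (b · f) i     ≡⟨ coeff-+ (a · f) (b · f) i ⟨
    coeff (a · f + b · f) i                 ∎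

  ·-assoc : ∀ a b f → (a ℚ.* b) · f ≈ a · (b · f)
  ·-assoc a b f .coeff≡ i = begin
    coeff ((a ℚ.* b) · f) i       ≡⟨ coeff-· (a ℚ.* b) f i ⟩
    (a ℚ.* b) ℚ.* coeff f i       ≡⟨ ℚ.*-assoc a b (coeff f i) ⟩
    a ℚ.* (b ℚ.* coeff f i)       ≡⟨ ≡.cong (a ℚ.*_) (coeff-· b f i) ⟨
    a ℚ.* coeff (b · f) i         ≡⟨ coeff-· a (b · f) i ⟨
    coeff (a · (b · f)) i         ∎

  +-commutativeMonoid : CommutativeMonoid 0ℓ 0ℓ
  +-commutativeMonoid = record
    { _≈_ = _≈_ ; _∙_ = _+_ ; ε = []
    ; isCommutativeMonoid = record
      { isMonoid = record
        { isSemigroup = record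
          { isMagma = record
            { isEquivalence = record { refl = refl ; sym = sym ; trans = trans } ; ∙-cong = +-cong }
          ; assoc = +-assoc }
        ; identity = (λ f → refl) , +-identityʳ }
      ; comm = +-comm } }

  open CommutativeSemigroupProperties
    (CommutativeMonoid.commutativeSemigroup +-commutativeMonoid) using (interchange; x∙yz≈y∙xz)

  0∷-+ : ∀ f g → (0ℚ ∷ (f + g)) ≈ (0ℚ ∷ f) + (0ℚ ∷ g)
  0∷-+ f g = ∷-cong (≡.sym (ℚ.+-identityʳ 0ℚ)) refl

  ·-0∷ : ∀ a f → a · (0ℚ ∷ f) ≈ (0ℚ ∷ a · f)
  ·-0∷ a f = ∷-cong (ℚ.*-zeroʳ a) refl

  *-congˡ : ∀ f {g g′} → g ≈ g′ → f * g ≈ f * g′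
  *-congˡ []      g≈g′ = refl
  *-congˡ (a ∷ f) g≈g′ = +-cong (·-congˡ a g≈g′) (∷-cong ≡.refl (*-congˡ f g≈g′))

  -- A list of zeros equals `[]` without being `[]`, so congruence in the first factor has to
  -- compare lists of different lengths.
  *-zeroˡ : ∀ f g → f ≈ [] → f * g ≈ []
  *-zeroˡ []      g f≈0 = refl
  *-zeroˡ (a ∷ f) g f≈0 =
    trans (+-cong (trans (·-congʳ g (f≈0 .coeff≡ 0)) (0·f≈0 g))
                  (∷-cong ≡.refl (*-zeroˡ f g (coeffwise λ i → f≈0 .coeff≡ (suc i)))))
          (P.∷≈0 ≡.refl refl)

  *-congʳ : ∀ f f′ g → f ≈ f′ → f * g ≈ f′ * g
  *-congʳ []      f′       g f≈f′ = sym (*-zeroˡ f′ g (sym f≈f′))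
  *-congʳ (a ∷ f) []       g f≈f′ = *-zeroˡ (a ∷ f) g f≈f′
  *-congʳ (a ∷ f) (b ∷ f′) g f≈f′ = +-cong (·-congʳ g (f≈f′ .coeff≡ 0))
    (∷-cong ≡.refl (*-congʳ f f′ g (coeffwise λ i → f≈f′ .coeff≡ (suc i))))

  distribʳ : ∀ h f g → (f + g) * h ≈ f * h + g * h
  distribʳ h []      g       = refl
  distribʳ h (a ∷ f) []      = sym (+-identityʳ _)
  distribʳ h (a ∷ f) (b ∷ g) =
    trans (+-cong (·-distribʳ a b h) (trans (∷-cong ≡.refl (distribʳ h f g)) (0∷-+ (f * h) (g * h))))
          (interchange (a · h) (b · h) (0ℚ ∷ f * h) (0ℚ ∷ g * h))

  distribˡ : ∀ f g h → f * (g + h) ≈ f * g + f * h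
  distribˡ []      g h = refl
  distribˡ (a ∷ f) g h =
    trans (+-cong (·-distribˡ a g h) (trans (∷-cong ≡.refl (distribˡ f g h)) (0∷-+ (f * g) (f * h))))
          (interchange (a · g) (a · h) (0ℚ ∷ f * g) (0ℚ ∷ f * h))

  ·-* : ∀ a f g → (a · f) * g ≈ a · (f * g)
  ·-* a []      g = refl
  ·-* a (b ∷ f) g =
    trans (+-cong (·-assoc a b g) (trans (∷-cong ≡.refl (·-* a f g)) (sym (·-0∷ a (f * g)))))
          (sym (·-distribˡ a (b · g) (0ℚ ∷ f * g)))

  0∷-* : ∀ f g → (0ℚ ∷ f) * g ≈ (0ℚ ∷ f * g)
  0∷-* f g = +-cong (0·f≈0 g) (refl {0ℚ ∷ f * g})

  *-assoc : ∀ f g h → (f * g) * h ≈ f * (g * h)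
  *-assoc []      g h = refl
  *-assoc (a ∷ f) g h =
    trans (distribʳ h (a · g) (0ℚ ∷ f * g))
          (+-cong (·-* a g h) (trans (0∷-* (f * g) h) (∷-cong ≡.refl (*-assoc f g h))))

  -- The mirror image of the defining clause of `_*_`; commutativity follows by comparing the two
  -- expansions.
  *-∷ : ∀ f b g → f * (b ∷ g) ≈ b · f + (0ℚ ∷ f * g)
  *-∷ []      b g = coeffwise λ { zero → ≡.refl ; (suc _) → ≡.refl }
  *-∷ (a ∷ f) b g = ∷-cong (≡.cong (ℚ._+ 0ℚ) (ℚ.*-comm a b))
    (trans (+-cong refl (*-∷ f b g)) (x∙yz≈y∙xz (a · g) (b · f) (0ℚ ∷ f * g)))

  *-comm : ∀ f g → f * g ≈ g * f
  *-comm f []      = zeroʳ f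
    where
    zeroʳ : ∀ f → f * [] ≈ []
    zeroʳ []      = refl
    zeroʳ (a ∷ f) .coeff≡ zero    = ≡.refl
    zeroʳ (a ∷ f) .coeff≡ (suc i) = zeroʳ f .coeff≡ i
  *-comm f (b ∷ g) = trans (*-∷ f b g) (+-cong refl (∷-cong ≡.refl (*-comm f g)))

  *-identityˡ : ∀ f → P.1# * f ≈ f
  *-identityˡ f .coeff≡ i = begin
    coeff (P.1# * f) i                             ≡⟨ coeff-∷* 1ℚ [] f i ⟩
    1ℚ ℚ.* coeff f i ℚ.+ coeff (0ℚ ∷ []) i         ≡⟨ ≡.cong₂ ℚ._+_ (ℚ.*-identityˡ (coeff f i)) (coeff-0 i) ⟩
    coeff f i ℚ.+ 0ℚ                               ≡⟨ ℚ.+-identityʳ (coeff f i) ⟩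
    coeff f i                                      ∎
    where
    coeff-0 : ∀ i → coeff (0ℚ ∷ []) i ≡ 0ℚ
    coeff-0 zero    = ≡.refl
    coeff-0 (suc i) = ≡.refl

module Polynomials where
  open CommutativeRing ℚ[q]-commutativeRing
    using (setoid; refl; sym; trans; +-cong; +-congˡ; +-congʳ; +-identityʳ; -‿inverseʳ;
           *-congˡ; *-congʳ; *-identityʳ; *-comm; zeroˡ; semiring; *-monoid; +-abelianGroup)
  open import Algebra.Properties.AbelianGroup +-abelianGroup using (x∙y⁻¹≈ε⇒x≈y)
  open SemiringExp semiring using (^-assocʳ)
  open SemiringMult semiring using () renaming (_×_ to _×′_)
  open RingSolver ℚ[q]-commutativeRing
  open RingTheory ℚ[q]-commutativeRing
  open SumSnoc *-monoid using () renaming (sum-snoc to product-snoc)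

  -- Degree less than `d`, in a form that covers the zero polynomial and ignores trailing zeros.
  Below : ℕ → ℚ[q] → Set
  Below d f = ∀ {i} → d ℕ.≤ i → coeff f i ≡ 0ℚ

  record Monic (d : ℕ) (f : ℚ[q]) : Set where
    constructor monic
    field
      lead  : coeff f d ≡ 1ℚ
      above : Below (suc d) f

  open Monic

  Monic-resp : ∀ {d f g} → f P.≈ g → Monic d f → Monic d g
  Monic-resp f≈g (monic lead above) = monic
    (≡.trans (≡.sym (f≈g .coeff≡ _)) lead) λ d<i → ≡.trans (≡.sym (f≈g .coeff≡ _)) (above d<i)

  leading : ∀ f → f P.≈ P.0# ⊎ ∃ λ d → coeff f d ≢ 0ℚ × Below (suc d) f
  leading []      = inj₁ refl
  leading (a ∷ f) with leading f
  ... | inj₂ (d , f-lead , f-above) = inj₂ (suc d , f-lead , λ { {suc i} (ℕ.s≤s d<i) → f-above d<i })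
  ... | inj₁ f≈0 with a ℚ.≟ 0ℚ
  ...   | yes a≡0 = inj₁ (P.∷≈0 a≡0 f≈0)
  ...   | no  a≢0 = inj₂ (0 , a≢0 , λ { {suc i} _ → f≈0 .coeff≡ i })

  all-0⇒≈0 : ∀ {f} → All (_≡ 0ℚ) f → f P.≈ P.0#
  all-0⇒≈0 []         = refl
  all-0⇒≈0 (a≡0 ∷ f₀) = P.∷≈0 a≡0 (all-0⇒≈0 f₀)

  ≈0⇒all-0 : ∀ f → f P.≈ P.0# → All (_≡ 0ℚ) f
  ≈0⇒all-0 []      _   = []
  ≈0⇒all-0 (a ∷ f) f≈0 = f≈0 .coeff≡ 0 ∷ ≈0⇒all-0 f (coeffwise λ i → f≈0 .coeff≡ (suc i))

  -- Long division locates the coefficient to be cancelled through the computed `P.degree`.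
  Monic⇒degree : ∀ {d} f → Monic d f → P.degree f ≡ d
  Monic⇒degree []      (monic lead _) = contradiction (≡.sym lead) ℚ.1≢0
  Monic⇒degree {zero} (a ∷ f) (monic lead above) with all? (ℚ._≟ 0ℚ) f
  ... | yes _ = ≡.refl
  ... | no ¬0 = contradiction (≈0⇒all-0 f (coeffwise λ i → above {suc i} (ℕ.s≤s ℕ.z≤n))) ¬0
  Monic⇒degree {suc d} (a ∷ f) (monic lead above) with all? (ℚ._≟ 0ℚ) f
  ... | yes f₀ = contradiction (≡.trans (≡.sym lead) (all-0⇒≈0 f₀ .coeff≡ d)) ℚ.1≢0
  ... | no _   = ≡.cong suc (Monic⇒degree f (monic lead λ d<i → above (ℕ.s≤s d<i)))

  Below-* : ∀ {m d} f g → Below (suc m) f → Below (suc d) g →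
    coeff (f P.* g) (m ℕ.+ d) ≡ coeff f m ℚ.* coeff g d × Below (suc (m ℕ.+ d)) (f P.* g)
  Below-* {d = d} []      g f< g< = ≡.sym (ℚ.*-zeroˡ (coeff g d)) , λ _ → ≡.refl
  Below-* {zero} {d} (a ∷ f) g f< g< = (coeffs d) ,
    λ {i} d<i → ≡.trans (coeffs i) (≡.trans (≡.cong (a ℚ.*_) (g< d<i)) (ℚ.*-zeroʳ a))
    where
    open ≡.≡-Reasoning
    f*g≈0 : f P.* g P.≈ P.0#
    f*g≈0 = trans (*-congʳ {g} {f} {P.0#} (coeffwise λ i → f< {suc i} (ℕ.s≤s ℕ.z≤n))) (zeroˡ g)
    coeffs : ∀ i → coeff ((a ∷ f) P.* g) i ≡ a ℚ.* coeff g i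
    coeffs i = begin
      coeff ((a ∷ f) P.* g) i                         ≡⟨ P.coeff-∷* a f g i ⟩
      a ℚ.* coeff g i ℚ.+ coeff (0ℚ ∷ f P.* g) i
        ≡⟨ ≡.cong (a ℚ.* coeff g i ℚ.+_) (P.∷≈0 ≡.refl f*g≈0 .coeff≡ i) ⟩
      a ℚ.* coeff g i ℚ.+ 0ℚ                          ≡⟨ ℚ.+-identityʳ _ ⟩
      a ℚ.* coeff g i                                 ∎
  Below-* {suc m} {d} (a ∷ f) g f< g<
    with fg-lead , fg-above ← Below-* {m} {d} f g (λ m<i → f< (ℕ.s≤s m<i)) g< =
    ≡.trans (coeffs (ℕ.m≤n+m d m)) fg-lead ,
    λ { {suc i} (ℕ.s≤s m+d<i) →
          ≡.trans (coeffs (ℕ.≤-trans (ℕ.m≤n+m d m) (ℕ.<⇒≤ m+d<i))) (fg-above m+d<i) }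
    where
    open ≡.≡-Reasoning
    coeffs : ∀ {i} → d ℕ.≤ i → coeff ((a ∷ f) P.* g) (suc i) ≡ coeff (f P.* g) i
    coeffs {i} d≤i = begin
      coeff ((a ∷ f) P.* g) (suc i)                   ≡⟨ P.coeff-∷* a f g (suc i) ⟩
      a ℚ.* coeff g (suc i) ℚ.+ coeff (f P.* g) i
        ≡⟨ ≡.cong (λ x → a ℚ.* x ℚ.+ coeff (f P.* g) i) (g< (ℕ.s≤s d≤i)) ⟩
      a ℚ.* 0ℚ ℚ.+ coeff (f P.* g) i                  ≡⟨ ≡.cong (ℚ._+ coeff (f P.* g) i) (ℚ.*-zeroʳ a) ⟩
      0ℚ ℚ.+ coeff (f P.* g) i                        ≡⟨ ℚ.+-identityˡ _ ⟩
      coeff (f P.* g) i                               ∎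

  Monic-* : ∀ {m d f g} → Monic m f → Monic d g → Monic (m ℕ.+ d) (f P.* g)
  Monic-* {f = f} {g} f-monic g-monic
    with fg-lead , fg-above ← Below-* f g (above f-monic) (above g-monic) = monic
      (≡.trans fg-lead (≡.trans (≡.cong₂ ℚ._*_ (lead f-monic) (lead g-monic)) (ℚ.*-identityˡ 1ℚ)))
      fg-above

  lead*Monic : ∀ {m d} f g → Below (suc m) f → Monic d g → coeff (f P.* g) (m ℕ.+ d) ≡ coeff f m
  lead*Monic {m} f g f-above (monic g-lead g-above) =
    ≡.trans (proj₁ (Below-* f g f-above g-above))
            (≡.trans (≡.cong (coeff f m ℚ.*_) g-lead) (ℚ.*-identityʳ _))

  -- As `g` is monic, the leading coefficient of the product sits at m + d and equals that of `f`.
  -- Any other position of e relative to m + d makes a leading coefficient vanish.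
  Monic-quotient : ∀ {d e f g h} → f P.* g P.≈ h → Monic d g → Monic e h → ∃ λ m → Monic m f
  Monic-quotient {d} {e} {f} {g} {h} fg≈h g-monic (monic h-lead h-above) with leading f
  ... | inj₁ f≈0 = contradiction
          (≡.trans (≡.sym h-lead) (trans (sym fg≈h) (trans (*-congʳ f≈0) (zeroˡ g)) .coeff≡ e)) ℚ.1≢0
  ... | inj₂ (m , f-lead , f-above) with ℕ.<-cmp (m ℕ.+ d) e
  ...   | tri< m+d<e _ _ = contradiction
            (≡.trans (≡.sym h-lead) (≡.trans (≡.sym (fg≈h .coeff≡ e))
              (proj₂ (Below-* f g f-above (above g-monic)) m+d<e))) ℚ.1≢0
  ...   | tri> _ _ e<m+d = contradiction
            (≡.trans (≡.sym (lead*Monic f g f-above g-monic))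
              (≡.trans (fg≈h .coeff≡ (m ℕ.+ d)) (h-above e<m+d))) f-lead
  ...   | tri≈ _ ≡.refl _ = m , monic
            (≡.trans (≡.sym (lead*Monic f g f-above g-monic)) (≡.trans (fg≈h .coeff≡ _) h-lead))
            f-above

  -- A nonzero multiple of `g` has degree at least d. This is the uniqueness of the remainder in
  -- long division.
  Monic-multiple-Below : ∀ {d g} w → Monic d g → Below d (w P.* g) → w P.* g P.≈ P.0#
  Monic-multiple-Below {d} {g} w g-monic wg< with leading w
  ... | inj₁ w≈0 = trans (*-congʳ w≈0) (zeroˡ g)
  ... | inj₂ (m , w-lead , w-above) = contradiction
          (≡.trans (≡.sym (lead*Monic w g w-above g-monic)) (wg< (ℕ.m≤n+m d m))) w-lead

  coeff-sub : ∀ f g i → coeff (f P.- g) i ≡ coeff f i ℚ.- coeff g i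
  coeff-sub f g i = ≡.trans (P.coeff-+ f (P.- g) i) (≡.cong (coeff f i ℚ.+_) (P.coeff-- g i))

  Below-- : ∀ {d f g} → Below d f → Below d g → Below d (f P.- g)
  Below-- {f = f} {g} f< g< {i} d≤i = ≡.trans (coeff-sub f g i) (≡.cong₂ ℚ._-_ (f< d≤i) (g< d≤i))

  const : ℚ → ℚ[q]
  const a = a ∷ []

  const-* : ∀ a f → const a P.* f P.≈ a P.· f
  const-* a f .coeff≡ i = ≡.trans (P.coeff-∷* a [] f i)
    (≡.trans (≡.cong₂ ℚ._+_ (≡.sym (P.coeff-· a f i)) (P.∷≈0 {f = []} ≡.refl refl .coeff≡ i))
      (ℚ.+-identityʳ _))

  quotRem-spec : ∀ {d} g → Monic d g → ∀ f →
    let u , r = P.quotRem f g in f P.≈ u P.* g P.+ r × Below d r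
  quotRem-spec {d} g g-monic []      = refl , λ _ → ≡.refl
  quotRem-spec {d} g g-monic (a ∷ f) = a∷f≈ , bound
    where
    u = proj₁ (P.quotRem f g)
    r = proj₂ (P.quotRem f g)
    f≈ = proj₁ (quotRem-spec g g-monic f)
    r< = proj₂ (quotRem-spec g g-monic f)
    c = coeff (a ∷ r) (P.degree g)
    open import Relation.Binary.Reasoning.Setoid setoid
    a∷f≈ : (a ∷ f) P.≈ (c ∷ u) P.* g P.+ ((a ∷ r) P.- c P.· g)
    a∷f≈ = begin
      a ∷ f
        ≈⟨ (coeffwise λ { zero → ≡.refl ; (suc i) → f≈ .coeff≡ i }) ⟩
      a ∷ (u P.* g P.+ r)
        ≈⟨ (coeffwise λ { zero → ≡.sym (ℚ.+-identityˡ a) ; (suc i) → ≡.refl }) ⟩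
      (0ℚ ∷ u P.* g) P.+ (a ∷ r)
        ≈⟨ solve 3 (λ x y z → x :+ y := (z :+ x) :+ (y :- z)) refl (0ℚ ∷ u P.* g) (a ∷ r) (c P.· g) ⟩
      (c ∷ u) P.* g P.+ ((a ∷ r) P.- c P.· g) ∎
    bound : Below d ((a ∷ r) P.- c P.· g)
    bound {i} d≤i with ℕ.m≤n⇒m<n∨m≡n d≤i
    ... | inj₂ ≡.refl = ≡.trans (coeff-sub (a ∷ r) (c P.· g) d)
            (≡.trans (≡.cong (λ x → coeff (a ∷ r) d ℚ.- x) (≡.trans (P.coeff-· c g d)
              (≡.trans (≡.cong (c ℚ.*_) (lead g-monic)) (ℚ.*-identityʳ c))))
              (≡.trans (≡.cong (λ e → coeff (a ∷ r) d ℚ.- coeff (a ∷ r) e) (Monic⇒degree g g-monic))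
                (ℚ.+-inverseʳ (coeff (a ∷ r) d))))
    ... | inj₁ d<i = Below-- {suc d} {a ∷ r} {c P.· g} (λ { (ℕ.s≤s d≤i) → r< d≤i })
            (λ {i} d<i → ≡.trans (P.coeff-· c g i)
               (≡.trans (≡.cong (c ℚ.*_) (above g-monic d<i)) (ℚ.*-zeroʳ c))) d<i

  quot-exact : ∀ {d f g} → Monic d g → g ∣ f → P.quot f g P.* g P.≈ f
  quot-exact {d} {f} {g} g-monic (k , kg≈f) = begin
    u P.* g                    ≈⟨ +-identityʳ _ ⟨
    u P.* g P.+ P.0#           ≈⟨ +-congˡ r≈0 ⟨
    u P.* g P.+ r              ≈⟨ f≈ ⟨
    f                          ∎
    where
    open import Relation.Binary.Reasoning.Setoid setoid
    u = proj₁ (P.quotRem f g)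
    r = proj₂ (P.quotRem f g)
    f≈ = proj₁ (quotRem-spec g g-monic f)
    [k-u]g≈r : (k P.- u) P.* g P.≈ r
    [k-u]g≈r = begin
      (k P.- u) P.* g               ≈⟨ solve 3 (λ k u g → (k :- u) :* g := k :* g :- u :* g) refl k u g ⟩
      k P.* g P.- u P.* g           ≈⟨ +-congʳ (trans kg≈f f≈) ⟩
      (u P.* g P.+ r) P.- u P.* g   ≈⟨ solve 2 (λ x r → (x :+ r) :- x := r) refl (u P.* g) r ⟩
      r                             ∎
    r≈0 : r P.≈ P.0#
    r≈0 = trans (sym [k-u]g≈r) (Monic-multiple-Below (k P.- u) g-monic
      λ {i} d≤i → ≡.trans ([k-u]g≈r .coeff≡ i) (proj₂ (quotRem-spec g g-monic f) d≤i))

  const-inverse : ∀ {a} → a ≢ 0ℚ → ∃ λ b → const a P.* const b P.≈ P.1# × b ℚ.* a ≡ 1ℚ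
  const-inverse {a} a≢0 = 1/a , trans (const-* a (const 1/a)) (coeffwise
    λ { zero → ℚ.*-inverseʳ a ; (suc _) → ≡.refl }) , ℚ.*-inverseˡ a
    where
    instance _ = ℚ.≢-nonZero a≢0
    1/a = ℚ.1/ a

  normalise : ∀ {d f} → coeff f d ≢ 0ℚ → Below (suc d) f →
    ∃₂ λ a b → a P.* b P.≈ P.1# × Monic d (b P.* f)
  normalise {d} {f} f-lead f-above with b , ab≈1 , ba≡1 ← const-inverse f-lead =
    const (coeff f d) , const b , ab≈1 , Monic-resp (sym (const-* b f)) (monic
      (≡.trans (P.coeff-· b f d) ba≡1)
      λ {i} d<i → ≡.trans (P.coeff-· b f i) (≡.trans (≡.cong (b ℚ.*_) (f-above d<i)) (ℚ.*-zeroʳ b)))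

  -- Euclid's algorithm, terminating by the degree of the divisor. Each remainder is made monic,
  -- since `quotRem-spec` covers only monic divisors.
  gcd-Monic : ∀ {d} f g → Monic d g → Acc ℕ._<_ d → Gcd f g
  gcd-Monic {d} f g g-monic (acc rec)
    with f≈ , r< ← quotRem-spec g g-monic f | leading (proj₂ (P.quotRem f g))
  ... | inj₁ r≈0 = gcd-step (P.quot f g) (trans f≈ (+-congˡ r≈0)) (gcd-0ʳ refl)
  ... | inj₂ (e , r-lead , r-above) with a , b , ab≈1 , r-monic ← normalise r-lead r-above =
    gcd-step (P.quot f g) f≈ (gcd-unit a b ab≈1 (gcd-Monic g _ r-monic (rec e<d)))
    where
    e<d : e ℕ.< d
    e<d = ℕ.≰⇒> λ d≤e → r-lead (r< d≤e)

  gcd : ∀ f g → g P.≉ P.0# → Gcd f g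
  gcd f g g≉0 with leading g
  ... | inj₁ g≈0 = contradiction g≈0 g≉0
  ... | inj₂ (d , g-lead , g-above) with a , b , ab≈1 , g-monic ← normalise g-lead g-above =
    gcd-unit a b ab≈1 (gcd-Monic f _ g-monic (<-wellFounded d))

  -- Cyclotomic polynomials

  qⁿ-1 : ℕ → ℚ[q]
  qⁿ-1 n = P.X P.^ n P.- P.1#

  -- For n > 0 the index d = 0 contributes 1, because 0 divides only 0; the meaningless `Φ 0` does
  -- not enter.
  factor : ℕ → ℕ → ℚ[q]
  factor n d = if does (d ℕ.∣? n) then Φ d else P.1#

  ∏Φ : ℕ → ℕ → ℚ[q]
  ∏Φ n k = P.product {k} λ d → factor n (toℕ d)

  -- Well-founded recursion unfolds once its body is known to depend only on the values of the
  -- recursive calls. Here the factors agree pointwise, and so do their products.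
  Φ-unfold : ∀ n → Φ n ≡ P.quot (qⁿ-1 n) (∏Φ n n)
  Φ-unfold n = FixPoint.unfold-wfRec <-wellFounded (λ _ → ℚ[q]) _ Φ-ext {n}
    where
    Φ-ext : ∀ n {Φ< Φ<′ : ∀ {d} → d ℕ.< n → ℚ[q]} → (∀ {d} (d<n : d ℕ.< n) → Φ< d<n ≡ Φ<′ d<n) →
      P.quot (qⁿ-1 n) (P.product λ (d : Fin n) → if does (toℕ d ℕ.∣? n) then Φ< (toℕ<n d) else P.1#) ≡
      P.quot (qⁿ-1 n) (P.product λ (d : Fin n) → if does (toℕ d ℕ.∣? n) then Φ<′ (toℕ<n d) else P.1#)
    Φ-ext n eq = ≡.cong (P.quot (qⁿ-1 n)) (MonoidSum.sum-cong-≗ *-monoid {n} λ d →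
      ≡.cong (if does (toℕ d ℕ.∣? n) then_else P.1#) (eq (toℕ<n d)))

  factor-elim : ∀ {p n d} (Q : ℚ[q] → Set p) → (d ℕ.∣ n → Q (Φ d)) → Q P.1# → Q (factor n d)
  factor-elim {n = n} {d} Q QΦ Q1 with d ℕ.∣? n
  ... | yes d∣n = QΦ d∣n
  ... | no  _   = Q1

  factor-∣ : ∀ {n d} → d ℕ.∣ n → factor n d P.≈ Φ d
  factor-∣ {n} {d} d∣n with d ℕ.∣? n
  ... | yes _  = refl
  ... | no d∤n = contradiction d∣n d∤n

  ∏Φ-suc : ∀ n k → ∏Φ n (suc k) P.≈ ∏Φ n k P.* factor n k
  ∏Φ-suc n k = product-snoc (factor n) k

  ∏Φ-elim : ∀ {p n} (Q : ℚ[q] → Set p) → 0 ℕ.< n → (∀ {f g} → f P.≈ g → Q f → Q g) → Q P.1# →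
    ∀ k → (∀ {d f} → 0 ℕ.< d → d ℕ.< k → d ℕ.∣ n → Q f → Q (f P.* Φ d)) → Q (∏Φ n k)
  ∏Φ-elim Q 0<n resp Q1 zero    step = Q1
  ∏Φ-elim {n = n} Q 0<n resp Q1 (suc k) step = resp (sym (∏Φ-suc n k))
    (factor-elim {n = n} {k} (λ g → Q (∏Φ n k P.* g))
      (λ k∣n → step (pos k∣n) ℕ.≤-refl k∣n Q-prev) (resp (sym (*-identityʳ _)) Q-prev))
    where
    pos : k ℕ.∣ n → 0 ℕ.< k
    pos k∣n = ℕ.n≢0⇒n>0 λ { ≡.refl → ℕ.<⇒≢ 0<n (≡.sym (ℕ.0∣⇒≡0 k∣n)) }
    Q-prev : Q (∏Φ n k)
    Q-prev = ∏Φ-elim Q 0<n resp Q1 k λ 0<d d<k → step 0<d (ℕ.m≤n⇒m≤1+n d<k)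

  ∏Φ-mono : ∀ n {k l} → k ℕ.≤′ l → ∏Φ n k ∣ ∏Φ n l
  ∏Φ-mono n ℕ.≤′-refl = ∣ʳ-refl
  ∏Φ-mono n {l = suc l} (ℕ.≤′-step k≤l) =
    ∣ʳ-trans (∏Φ-mono n k≤l) (∣ʳ-respʳ-≈ (sym (∏Φ-suc n l)) (x∣xy (∏Φ n l) (factor n l)))

  -- Divisibility holds factor by factor: a divisor of m is one of n, and elsewhere the factor on
  -- the left is 1.
  ∏Φ-∣ : ∀ {m n} k → m ℕ.∣ n → ∏Φ m k ∣ ∏Φ n k
  ∏Φ-∣ zero m∣n = ∣ʳ-refl
  ∏Φ-∣ {m} {n} (suc k) m∣n = ∣ʳ-respˡ-≈ (sym (∏Φ-suc m k)) (∣ʳ-respʳ-≈ (sym (∏Φ-suc n k))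
    (∙-cong-∣ (∏Φ-∣ k m∣n) (factor-elim {n = m} {k} (_∣ factor n k)
      (λ k∣m → ∣ʳ-respʳ-≈ (sym (factor-∣ {n} {k} (ℕ.∣-trans k∣m m∣n))) ∣ʳ-refl)
      (factor n k , *-identityʳ (factor n k)))))

  Below-1⇒const : ∀ {f} → Below 1 f → f P.≈ const (coeff f 0)
  Below-1⇒const above .coeff≡ zero    = ≡.refl
  Below-1⇒const above .coeff≡ (suc i) = above (ℕ.s≤s ℕ.z≤n)

  coeff₀-×1 : ∀ n → 0ℚ ℚ.≤ coeff (n ×′ P.1#) 0
  coeff₀-×1 zero    = ℚ.≤-refl
  coeff₀-×1 (suc n) = ℚ.≤-trans (ℚ.+-mono-≤ (ℚ.nonNegative⁻¹ 1ℚ) (coeff₀-×1 n))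
    (ℚ.≤-reflexive (≡.sym (P.coeff-+ P.1# (n ×′ P.1#) 0)))

  Below-×1 : ∀ n → Below 1 (n ×′ P.1#)
  Below-×1 zero    _ = ≡.refl
  Below-×1 (suc n) {suc i} 1≤i = ≡.trans (P.coeff-+ P.1# (n ×′ P.1#) (suc i))
    (≡.trans (≡.cong (0ℚ ℚ.+_) (Below-×1 n 1≤i)) (ℚ.+-identityʳ 0ℚ))

  -- Characteristic zero enters here: the multiple is a constant polynomial whose coefficient is
  -- positive, hence invertible.
  ×1-inverse : ∀ n → ∃ λ f → suc n ×′ P.1# P.* f P.≈ P.1#
  ×1-inverse n = const (proj₁ 1/c) ,
    trans (*-congʳ {const (proj₁ 1/c)} {suc n ×′ P.1#} (Below-1⇒const (Below-×1 (suc n)))) (proj₁ (proj₂ 1/c))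
    where
    0<c : 0ℚ ℚ.< coeff (suc n ×′ P.1#) 0
    0<c = ℚ.<-≤-trans (ℚ.+-mono-<-≤ (ℚ.positive⁻¹ 1ℚ) (coeff₀-×1 n))
      (ℚ.≤-reflexive (≡.sym (P.coeff-+ P.1# (n ×′ P.1#) 0)))
    1/c = const-inverse λ c≡0 → ℚ.<⇒≢ 0<c (≡.sym c≡0)

  ×1-comaximal : ∀ {f h m} n → 0 ℕ.< n → m P.≈ n ×′ P.1# P.+ h P.* f → Comaximal f m
  ×1-comaximal {f} {h} {m} (suc n) _ m≈ =
    unit+multiple-comaximal {f} {h} {m} (proj₂ (×1-inverse n)) m≈

  *-cancelʳ : ∀ {f g h} → h P.≉ P.0# → f P.* h P.≈ g P.* h → f P.≈ g
  *-cancelʳ {f} {g} {h} h≉0 fh≈gh = Sum.[ x∙y⁻¹≈ε⇒x≈y f g , (λ h≈0 → contradiction h≈0 h≉0) ]′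
    (P.f*g≈0 (f P.- g) h (begin
      (f P.- g) P.* h           ≈⟨ solve 3 (λ f g h → (f :- g) :* h := f :* h :- g :* h) refl f g h ⟩
      f P.* h P.- g P.* h       ≈⟨ +-congʳ fh≈gh ⟩
      g P.* h P.- g P.* h       ≈⟨ -‿inverseʳ (g P.* h) ⟩
      P.0#                      ∎))
    where open import Relation.Binary.Reasoning.Setoid setoid

  Monic-1 : Monic 0 P.1#
  Monic-1 = monic ≡.refl λ { (ℕ.s≤s _) → ≡.refl }

  Monic-X^ : ∀ n → Monic n (P.X P.^ n)
  Monic-X^ zero    = Monic-1
  Monic-X^ (suc n) = Monic-* {f = P.X} (monic ≡.refl λ { (ℕ.s≤s (ℕ.s≤s _)) → ≡.refl }) (Monic-X^ n)

  Monic-qⁿ-1 : ∀ {n} → 0 ℕ.< n → Monic n (qⁿ-1 n)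
  Monic-qⁿ-1 {suc n} _ =
    monic (≡.trans (coeff-sub (P.X P.^ suc n) P.1# (suc n)) (≡.cong (ℚ._- 0ℚ) (lead (Monic-X^ (suc n)))))
          (Below-- {f = P.X P.^ suc n} {P.1#} (above (Monic-X^ (suc n))) λ { (ℕ.s≤s _) → ≡.refl })

  Monic⇒≉0 : ∀ {d f} → Monic d f → f P.≉ P.0#
  Monic⇒≉0 f-monic f≈0 = ℚ.1≢0 (≡.trans (≡.sym (lead f-monic)) (f≈0 .coeff≡ _))

  record Cyclotomic (n : ℕ) : Set where
    field
      Φ*∏Φ  : Φ n P.* ∏Φ n n P.≈ qⁿ-1 n
      Φ-monic : ∃ λ d → Monic d (Φ n)

    Φ∣qⁿ-1 : Φ n ∣ qⁿ-1 n
    Φ∣qⁿ-1 = ∣ʳ-respʳ-≈ Φ*∏Φ (x∣xy (Φ n) (∏Φ n n))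

  open Cyclotomic

  -- With g = gcd(n, N), Φₙ divides (qⁿ-1)/(q^g-1), which is congruent to the nonzero
  -- constant n/g modulo q^g-1; and qⁿ ≡ 1 modulo Φₙ.
  Φ-comaximal′ : ∀ {n N} → 0 ℕ.< n → (∀ {d} → 0 ℕ.< d → d ℕ.≤ n → Cyclotomic d) → ¬ n ℕ.∣ N →
    Comaximal (Φ n) (qⁿ-1 N)
  Φ-comaximal′ {n} {N} 0<n cyclotomic n∤N = Comaximal-x^gcd-1 P.X n N (Φ∣qⁿ-1 Cₙ)
    (Comaximal-sym (Comaximal-∣ coprime-g-M Φ∣M))
    where
    open import Relation.Binary.Reasoning.Setoid setoid
    g = ℕ.gcd n N
    g∣n = ℕ.gcd[m,n]∣m n N
    instance
      n≢0 : ℕ.NonZero n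
      n≢0 = ℕ.>-nonZero 0<n
    g≤n : g ℕ.≤ n
    g≤n = ℕ.∣⇒≤ g∣n
    g<n : g ℕ.< n
    g<n = ℕ.≤∧≢⇒< g≤n λ g≡n → n∤N (≡.subst (ℕ._∣ N) g≡n (ℕ.gcd[m,n]∣n n N))
    0<g : 0 ℕ.< g
    0<g = ℕ.n≢0⇒n>0 λ g≡0 → ℕ.<⇒≢ 0<n (≡.sym (ℕ.gcd[m,n]≡0⇒m≡0 g≡0))
    Cₙ = cyclotomic 0<n ℕ.≤-refl
    C_g = cyclotomic 0<g g≤n
    e = ℕ._∣_.quotient g∣n
    n≡eg : n ≡ e ℕ.* g
    n≡eg = ℕ._∣_.equality g∣n
    M,h = geometric (P.X P.^ g) e
    M = proj₁ M,h
    h = proj₁ (proj₂ M,h)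
    M[q^g-1]≈ : M P.* qⁿ-1 g P.≈ qⁿ-1 n
    M[q^g-1]≈ = begin
      M P.* qⁿ-1 g                       ≈⟨ proj₁ (proj₂ (proj₂ M,h)) ⟩
      (P.X P.^ g) P.^ e P.- P.1#         ≈⟨ +-congʳ (^-assocʳ P.X g e) ⟩
      P.X P.^ (g ℕ.* e) P.- P.1#         ≡⟨ ≡.cong qⁿ-1 (≡.trans (ℕ.*-comm g e) (≡.sym n≡eg)) ⟩
      qⁿ-1 n                             ∎
    -- q^g - 1 is the product of the Φ_d with d dividing g. Each such d divides n and is at most g <
    -- n, so it occurs in `∏Φ n n`.
    q^g-1∣∏Φ : qⁿ-1 g ∣ ∏Φ n n
    q^g-1∣∏Φ = ∣ʳ-trans (∣ʳ-respˡ-≈ (begin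
        ∏Φ g (suc g)               ≈⟨ ∏Φ-suc g g ⟩
        ∏Φ g g P.* factor g g      ≈⟨ *-congˡ {∏Φ g g} (factor-∣ {g} {g} ℕ.∣-refl) ⟩
        ∏Φ g g P.* Φ g             ≈⟨ *-comm (∏Φ g g) (Φ g) ⟩
        Φ g P.* ∏Φ g g             ≈⟨ Φ*∏Φ C_g ⟩
        qⁿ-1 g                     ∎)
      (∏Φ-∣ (suc g) g∣n)) (∏Φ-mono n (ℕ.≤⇒≤′ g<n))
    -- qⁿ - 1 is both M (q^g - 1) and Φₙ times a multiple of q^g - 1; cancel q^g - 1.
    Φ∣M : Φ n ∣ M
    Φ∣M = k , *-cancelʳ (Monic⇒≉0 (Monic-qⁿ-1 0<g)) (begin
      k P.* Φ n P.* qⁿ-1 g     ≈⟨ solve 3 (λ k Φ x → k :* Φ :* x := Φ :* (k :* x)) refl k (Φ n) (qⁿ-1 g) ⟩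
      Φ n P.* (k P.* qⁿ-1 g)   ≈⟨ *-congˡ {Φ n} (_∣ʳ_.equality q^g-1∣∏Φ) ⟩
      Φ n P.* ∏Φ n n           ≈⟨ Φ*∏Φ Cₙ ⟩
      qⁿ-1 n                   ≈⟨ M[q^g-1]≈ ⟨
      M P.* qⁿ-1 g             ∎)
      where k = _∣ʳ_.quotient q^g-1∣∏Φ
    coprime-g-M : Comaximal (qⁿ-1 g) M
    coprime-g-M = ×1-comaximal {h = h} e (ℕ.n≢0⇒n>0 λ e≡0 → ℕ.<⇒≢ 0<n (≡.sym (≡.trans n≡eg (≡.cong (ℕ._* g) e≡0))))
      (proj₂ (proj₂ (proj₂ M,h)))

  ∏Φ-monic : ∀ {n} → 0 ℕ.< n → (∀ {d} → 0 ℕ.< d → d ℕ.< n → Cyclotomic d) →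
    ∃ λ d → Monic d (∏Φ n n)
  ∏Φ-monic {n} 0<n cyclotomic = ∏Φ-elim (λ f → ∃ λ d → Monic d f) 0<n
    (λ f≈g (d , f-monic) → d , Monic-resp f≈g f-monic) (0 , Monic-1) n
    λ 0<d d<n _ (m , f-monic) →
      m ℕ.+ proj₁ (Φ-monic (cyclotomic 0<d d<n)) , Monic-* f-monic (proj₂ (Φ-monic (cyclotomic 0<d d<n)))

  -- Exactness of the division that defines `Φ n`. Each factor divides qⁿ - 1, and distinct ones are
  -- comaximal: for d < k, Φ_d divides q^d - 1, which is comaximal with Φ_k because k does not
  -- divide d.
  ∏Φ∣qⁿ-1 : ∀ {n} → 0 ℕ.< n → (∀ {d} → 0 ℕ.< d → d ℕ.< n → Cyclotomic d) → ∏Φ n n ∣ qⁿ-1 n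
  ∏Φ∣qⁿ-1 {n} 0<n cyclotomic = go n ℕ.≤-refl
    where
    comaximal : ∀ {k} → 0 ℕ.< k → k ℕ.< n → ∀ j → j ℕ.≤ k → Comaximal (Φ k) (∏Φ n j)
    comaximal {k} 0<k k<n j j≤k = ∏Φ-elim (Comaximal (Φ k)) 0<n Comaximal-resp (Comaximal-1 (Φ k)) j
      λ {d} 0<d d<j _ coprime → Comaximal-* coprime (Comaximal-∣
        (Φ-comaximal′ 0<k (λ 0<e e≤k → cyclotomic 0<e (ℕ.≤-<-trans e≤k k<n))
          (ℕ.>⇒∤ ⦃ ℕ.>-nonZero 0<d ⦄ (ℕ.<-≤-trans d<j j≤k)))
        (Φ∣qⁿ-1 (cyclotomic 0<d (ℕ.<-trans (ℕ.<-≤-trans d<j j≤k) k<n))))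
    go : ∀ k → k ℕ.≤ n → ∏Φ n k ∣ qⁿ-1 n
    go zero    _   = qⁿ-1 n , *-identityʳ (qⁿ-1 n)
    go (suc k) k<n = ∣ʳ-respˡ-≈ (sym (∏Φ-suc n k)) (factor-elim {n = n} {k} (λ g → ∏Φ n k P.* g ∣ qⁿ-1 n)
      (λ k∣n → let 0<k = ℕ.n≢0⇒n>0 λ { ≡.refl → ℕ.<⇒≢ 0<n (≡.sym (ℕ.0∣⇒≡0 k∣n)) } in
        Comaximal⇒*∣ (Comaximal-sym (comaximal 0<k k<n k ℕ.≤-refl)) (go k (ℕ.<⇒≤ k<n))
          (∣ʳ-trans (Φ∣qⁿ-1 (cyclotomic 0<k k<n)) (x^d-1∣x^n-1 P.X k∣n)))
      (∣ʳ-respˡ-≈ (sym (*-identityʳ (∏Φ n k))) (go k (ℕ.<⇒≤ k<n))))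

  -- No circularity arises, since exactness at n uses comaximality only for indices below n.
  cyclotomic : ∀ n → 0 ℕ.< n → Cyclotomic n
  cyclotomic = <-rec _ λ n rec 0<n →
    let monic-∏Φ = ∏Φ-monic 0<n λ 0<d d<n → rec d<n 0<d
        Φ*∏Φ = ≡.subst (λ f → f P.* ∏Φ n n P.≈ qⁿ-1 n) (≡.sym (Φ-unfold n))
                 (quot-exact (proj₂ monic-∏Φ) (∏Φ∣qⁿ-1 0<n λ 0<d d<n → rec d<n 0<d))
    in record { Φ*∏Φ = Φ*∏Φ ; Φ-monic = Monic-quotient Φ*∏Φ (proj₂ monic-∏Φ) (Monic-qⁿ-1 0<n) }

  Φ-comaximal : ∀ {n N} → 0 ℕ.< n → ¬ n ℕ.∣ N → Comaximal (Φ n) (qⁿ-1 N)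
  Φ-comaximal 0<n = Φ-comaximal′ 0<n λ 0<d _ → cyclotomic _ 0<d

-- Congruences of rational functions

open import Defs
open Polynomials
open RingTheory ℚ[q]-commutativeRing
module ℚ[q] = CommutativeRing ℚ[q]-commutativeRing

module Congruences (M : ℚ[q]) where
  ℚ[q]/M : CommutativeRing 0ℓ 0ℓ
  ℚ[q]/M = R/M M

  module K = CommutativeRing ℚ[q]/M
  open SemiringExp K.semiring using () renaming (_^_ to _^′_) public
  open MonoidSum K.+-monoid using () renaming (sum to sum′)
  open Quotients ℚ[q]/M public

  -- Not definitional, because _^_ is parametrised by the whole semiring, its equality included.
  ^≡^′ : ∀ f n → f P.^ n ≡ f ^′ n
  ^≡^′ f zero    = ≡.refl
  ^≡^′ f (suc n) = ≡.cong (f P.*_) (^≡^′ f n)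

  -- Reduction modulo `M` of a fraction that need not be in lowest terms, defined where the
  -- denominator is a unit modulo `M`.
  _↦_ : ℚ⟨q⟩ → ℚ[q] → Set
  A ↦ a = IsQuotient (num A) (den A) a

  ↦-^ : ∀ {A a} → A ↦ a → ∀ n → (A ^ n) ↦ (a ^′ n)
  ↦-^ A↦a zero    = IsQuotient-/1 P.1#
  ↦-^ A↦a (suc n) = IsQuotient-* A↦a (↦-^ A↦a n)

  ↦-sum : ∀ {n} {A : Fin n → ℚ⟨q⟩} {a : Fin n → ℚ[q]} → (∀ i → A i ↦ a i) → sum A ↦ sum′ a
  ↦-sum {zero}  A↦a = IsQuotient-/1 P.0#
  ↦-sum {suc n} A↦a = IsQuotient-+ (A↦a zero) (↦-sum λ i → A↦a (suc i))

  -- The numerator of A - B is k M, and its denominator is comaximal with M. Cancelling the common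
  -- divisor of k and the denominator therefore already gives lowest terms, with M intact in the
  -- numerator.
  ↦⇒≡mod : ∀ {A B a b} → A ↦ a → B ↦ b → a K.≈ b → A ≡ B [mod M ]
  ↦⇒≡mod {A} {B} {a} {b} A↦a B↦b a≈b = record
    { lowest-terms = (x′ P.* M) / y′ [ y′≉0 ]
    ; represents   = cross (begin
        num A-B P.* y′              ≈⟨ ℚ[q].*-congʳ num≈ ⟩
        k P.* M P.* y′              ≈⟨ ℚ[q].*-congʳ (ℚ[q].*-congʳ x≈) ⟩
        divisor P.* x′ P.* M P.* y′
          ≈⟨ solve 4 (λ d x M y → d :* x :* M :* y := x :* M :* (d :* y)) ℚ[q].refl divisor x′ M y′ ⟩
        x′ P.* M P.* (divisor P.* y′)  ≈⟨ ℚ[q].*-congˡ {x′ P.* M} y≈ ⟨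
        x′ P.* M P.* den A-B        ∎)
    ; coprime = Comaximal⇒Coprime (Comaximal-sym (Comaximal-* (Comaximal-sym comaximal)
        (Comaximal-sym (Comaximal-∣ M,den (divisor , ℚ[q].sym y≈)))))
    ; divides = x′ , ℚ[q].refl
    }
    where
    open import Relation.Binary.Reasoning.Setoid ℚ[q].setoid
    open RingSolver ℚ[q]-commutativeRing
    A-B = A - B
    A-B↦ : A-B ↦ (a P.- b)
    A-B↦ = IsQuotient-+ A↦a (IsQuotient-neg B↦b)
    open IsQuotient A-B↦
    num≈0 : num A-B K.≈ P.0#
    num≈0 = K.trans x≈ay (K.trans (K.*-congʳ (K.trans (K.+-congʳ a≈b) (K.-‿inverseʳ b))) (K.zeroˡ (den A-B)))
    M∣num : M ∣ num A-B
    M∣num = ≋0⇒∣ M num≈0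
    k = _∣ʳ_.quotient M∣num
    num≈ : num A-B P.≈ k P.* M
    num≈ = ℚ[q].sym (_∣ʳ_.equality M∣num)
    M,den : Comaximal M (den A-B)
    M,den = inverse⇒Comaximal M (y⁻¹ , yy⁻¹≈1)
    open Gcd (gcd k (den A-B) (den≉0 A-B))
    y′≉0 : y′ P.≉ P.0#
    y′≉0 y′≈0 = den≉0 A-B (ℚ[q].trans y≈ (ℚ[q].trans (ℚ[q].*-congˡ {divisor} y′≈0) (ℚ[q].zeroʳ divisor)))

-- The sum modulo the square of a divisor of qⁿ - 1.

-- For n = 2N + 1, m n = N (2m) + m.
n∣2m⇒n∣m : ∀ {n} N → n ≡ suc (N ℕ.* 2) → ∀ m → n ℕ.∣ 2 ℕ.* m → n ℕ.∣ m
n∣2m⇒n∣m N ≡.refl m n∣2m = ℕ.∣m+n∣m⇒∣n (≡.subst (suc (N ℕ.* 2) ℕ.∣_) (split N m) (ℕ.n∣m*n m))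
  (ℕ.∣n⇒∣m*n N n∣2m)
  where
  split : ∀ N m → m ℕ.* suc (N ℕ.* 2) ≡ N ℕ.* (2 ℕ.* m) ℕ.+ m
  split = solve-∀

-- The q-series takes inverses as total functions of the index, whereas they exist only below `N`;
-- the default `x₀` fills the remaining places.
extend : ∀ {c p} {C : Set c} {Q : ℕ → C → Set p} (x₀ : C) N →
  (∀ {j} → j ℕ.< N → ∃ (Q j)) → ∃ λ (r : ℕ → C) → ∀ {j} → j ℕ.< N → Q j (r j)
extend {C = C} {Q} x₀ N h = r , λ {j} → r-spec j
  where
  r : ℕ → C
  r j with j ℕ.<? N
  ... | yes j<N = proj₁ (h j<N)
  ... | no  _   = x₀
  r-spec : ∀ j → j ℕ.< N → Q j (r j)
  r-spec j j<N with j ℕ.<? N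
  ... | yes j<N = proj₂ (h j<N)
  ... | no  j≮N = contradiction j<N j≮N

-- `F` stands for Φₙ, of which only these two properties are used.
module _ (F : ℚ[q]) {n : ℕ} (N : ℕ) (n≡1+2N : n ≡ suc (N ℕ.* 2)) (F∣qⁿ-1 : F ∣ qⁿ-1 n)
  (F-comaximal : ∀ {m} → ¬ n ℕ.∣ m → Comaximal F (qⁿ-1 m)) where

  private
    M = F P.^ 2
  open Congruences M

  1-q^-invertible : ∀ m → ¬ n ℕ.∣ m → ∃ λ v → (P.1# P.- P.X P.^ m) P.* v K.≈ P.1#
  1-q^-invertible m n∤m = Comaximal⇒inverse M
    (Comaximal-1-x {x = P.X P.^ m} (Comaximal-^2ˡ (F-comaximal n∤m)))

  X-inverse : ∃ λ p → P.X P.* p K.≈ P.1#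
  X-inverse = Comaximal⇒inverse M (Comaximal-^2ˡ (∣x^[1+n]-1⇒Comaximal (N ℕ.* 2)
    (≡.subst (λ m → F ∣ qⁿ-1 m) n≡1+2N F∣qⁿ-1)))

  p : ℚ[q]
  p = proj₁ X-inverse

  open QIdentity ℚ[q]/M P.X p (proj₂ X-inverse)

  odd≡ : ∀ j → odd P.X j ≡ P.X P.* (P.X P.^ 2) P.^ j
  odd≡ j = ≡.cong (P.X P.*_) (≡.sym (^≡^′ (P.X P.^ 2) j))

  odd≈ : ∀ j → P.X P.* (P.X P.^ 2) P.^ j P.≈ P.X P.^ suc (2 ℕ.* j)
  odd≈ j = ℚ[q].*-congˡ {P.X} (SemiringExp.^-assocʳ ℚ[q].semiring P.X 2 j)

  quad≡ : ∀ j → quad j ≡ P.X P.^ 4 P.* (P.X P.^ 4) P.^ j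
  quad≡ j = ≡.cong (P.X P.^ 4 P.*_) (≡.sym (^≡^′ (P.X P.^ 4) j))

  quad≈X^ : ∀ j → P.X P.^ 4 P.* (P.X P.^ 4) P.^ j P.≈ P.X P.^ (4 ℕ.* suc j)
  quad≈X^ j = SemiringExp.^-assocʳ ℚ[q].semiring P.X 4 (suc j)

  1+2j<n : ∀ {j} → j ℕ.< N → suc (2 ℕ.* j) ℕ.< n
  1+2j<n {j} j<N = ≡.subst (suc (2 ℕ.* j) ℕ.<_) (≡.sym (≡.trans n≡1+2N (≡.cong suc (ℕ.*-comm N 2))))
    (ℕ.s<s (ℕ.*-monoʳ-< 2 j<N))

  odd-invertible : ∀ {j} → j ℕ.< N → ∃ λ v → (P.1# P.- odd P.X j) P.* v K.≈ P.1#
  odd-invertible {j} j<N = proj₁ v , K.trans (K.*-congʳ (≈⇒≋ M (ℚ[q].+-congˡ {P.1#} (ℚ[q].-‿cong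
      (ℚ[q].trans (ℚ[q].reflexive (odd≡ j)) (odd≈ j)))))) (proj₂ v)
    where v = 1-q^-invertible (suc (2 ℕ.* j)) (ℕ.>⇒∤ (1+2j<n j<N))

  -- Oddness of n strips the factor 4 in two halvings, and 1 + j is too small to be a multiple of n.
  n∤4[1+j] : ∀ {j} → j ℕ.< N → ¬ n ℕ.∣ 4 ℕ.* suc j
  n∤4[1+j] {j} j<N n∣ = ℕ.>⇒∤ (ℕ.≤-<-trans (ℕ.s≤s (ℕ.m≤n*m j 2)) (1+2j<n j<N))
    (n∣2m⇒n∣m N n≡1+2N (suc j) (n∣2m⇒n∣m N n≡1+2N (2 ℕ.* suc j)
      (≡.subst (n ℕ.∣_) (ℕ.*-assoc 2 2 (suc j)) n∣)))

  quad-invertible : ∀ {j} → j ℕ.< N → ∃ λ v → (P.1# P.- quad j) P.* v K.≈ P.1#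
  quad-invertible {j} j<N = proj₁ v , K.trans (K.*-congʳ (≈⇒≋ M (ℚ[q].+-congˡ {P.1#} (ℚ[q].-‿cong
      (ℚ[q].trans (ℚ[q].reflexive (quad≡ j)) (quad≈X^ j)))))) (proj₂ v)
    where v = 1-q^-invertible (4 ℕ.* suc j) (n∤4[1+j] j<N)

  r = extend {Q = λ j v → (P.1# P.- odd P.X j) P.* v K.≈ P.1#} P.0# N odd-invertible
  s = extend {Q = λ j v → (P.1# P.- quad j) P.* v K.≈ P.1#} P.0# N quad-invertible

  open MonoidSum K.*-monoid using (sum-cong-≗) renaming (sum to product′)

  numerator≡ : ∀ k → P.⟨ P.X ⨾ P.X P.^ 2 ⟩ k ≡ product′ {k} (λ j → P.1# P.- odd P.X (toℕ j))
  numerator≡ k = sum-cong-≗ {k} λ j → ≡.cong (λ f → P.1# P.- f) (≡.sym (odd≡ (toℕ j)))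

  denominator≡ : ∀ k → P.⟨ P.X P.^ 4 ⨾ P.X P.^ 4 ⟩ k ≡ product′ {k} (λ j → P.1# P.- quad (toℕ j))
  denominator≡ k = sum-cong-≗ {k} λ j → ≡.cong (λ f → P.1# P.- f) (≡.sym (quad≡ (toℕ j)))

  summand : ℕ → ℚ⟨q⟩
  summand k = q ^ (k ℕ.^ 2) *
    (P.⟨ P.X ⨾ P.X P.^ 2 ⟩ k / P.⟨ P.X P.^ 4 ⨾ P.X P.^ 4 ⟩ k
      [ P.⟨⨾⟩-≉0 (P.X P.^ 4) (P.X P.^ 4) ≡.refl k ])

  term′ : ℕ → ℚ[q]
  term′ = term N (proj₁ r) (proj₁ s) (proj₂ r) (proj₂ s)

  summand↦ : ∀ {k} → k ℕ.≤ N → summand k ↦ term′ k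
  summand↦ {k} k≤N = IsQuotient-* (↦-^ {q} (IsQuotient-/1 P.X) (k ℕ.^ 2))
    (IsQuotient-resp (K.*-congʳ (K.reflexive (numerator≡ k)))
      (IsQuotient-/ (P.⟨ P.X ⨾ P.X P.^ 2 ⟩ k) (K.trans (K.*-congʳ (K.reflexive (denominator≡ k)))
        (product-inverse (λ j → P.1# P.- quad j) (proj₁ s) k λ j<k → proj₂ s (ℕ.<-≤-trans j<k k≤N)))))

  [1-q^n]²≈0 : (P.1# P.- odd P.X N) ^′ 2 K.≈ P.0#
  [1-q^n]²≈0 = ∣⇒≋0 M (∣x-1⇒^2∣[1-x]^2 {F} {odd P.X N} (∣ʳ-respʳ-≈ (ℚ[q].+-congʳ X^n≈odd) F∣qⁿ-1))
    where
    X^n≈odd : P.X P.^ n P.≈ odd P.X N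
    X^n≈odd = ℚ[q].trans
      (ℚ[q].reflexive (≡.cong (P.X P.^_) (≡.trans n≡1+2N (≡.cong suc (ℕ.*-comm N 2)))))
      (ℚ[q].trans (ℚ[q].sym (odd≈ N)) (ℚ[q].reflexive (≡.sym (odd≡ N))))

  sum↦ : (∑[ k ≤ N ] summand k) ↦ ((P.- p) ^′ triangular N)
  sum↦ = IsQuotient-resp (truncated-sum N (proj₁ r) (proj₁ s) (proj₂ r) (proj₂ s) [1-q^n]²≈0)
    (↦-sum {suc N} {λ k → summand (toℕ k)} {λ k → term′ (toℕ k)} λ k → summand↦ (ℕ.<⇒≤pred (toℕ<n k)))

  -q⁻¹↦ : ((den (- q)) / num (- q) [ -q≉0 ]) ↦ (P.- p)
  -q⁻¹↦ = isQuotient (P.- p) (K.trans -X*-p≈ (proj₂ X-inverse))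
    (K.sym (K.trans (K.*-comm (P.- p) (P.- P.X)) (K.trans -X*-p≈ (proj₂ X-inverse))))
    where
    open RingSolver ℚ[q]/M
    -X*-p≈ : P.- P.X P.* P.- p K.≈ P.X P.* p
    -X*-p≈ = solve 2 (λ x p → :- x :* :- p := x :* p) K.refl P.X p

  -- The case distinction follows the two clauses of `_^ℤ_[_]`: the negative of 0 is a non-negative
  -- exponent.
  power↦ : ∀ T → ((- q) ^ℤ (ℤ.- (+ T)) [ -q≉0 ]) ↦ ((P.- p) ^′ T)
  power↦ zero    = IsQuotient-/1 P.1#
  power↦ (suc T) = ↦-^ -q⁻¹↦ (suc T)

  congruence : (∑[ k ≤ N ] summand k) ≡ (- q) ^ℤ (ℤ.- (+ triangular N)) [ -q≉0 ] [mod M ]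
  congruence = ↦⇒≡mod sum↦ (power↦ (triangular N)) K.refl

-- The exponent (1 - n²)/8.

2*triangular : ∀ N → triangular N ℕ.* 2 ≡ N ℕ.* suc N
2*triangular zero    = ≡.refl
2*triangular (suc N) = ≡.trans (ℕ.*-distribʳ-+ 2 (suc N) (triangular N))
  (≡.trans (≡.cong (suc N ℕ.* 2 ℕ.+_) (2*triangular N)) (lemma N))
  where
  lemma : ∀ N → suc N ℕ.* 2 ℕ.+ N ℕ.* suc N ≡ suc N ℕ.* suc (suc N)
  lemma = solve-∀

[1+2N]² : ∀ N → suc (N ℕ.* 2) ℕ.* (suc (N ℕ.* 2) ℕ.* 1) ≡ suc (triangular N ℕ.* 8)
[1+2N]² N = ≡.trans (expand N) (≡.cong suc (≡.trans (≡.cong (ℕ._* 4) (≡.sym (2*triangular N)))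
  (ℕ.*-assoc (triangular N) 2 4)))
  where
  expand : ∀ N → suc (N ℕ.* 2) ℕ.* (suc (N ℕ.* 2) ℕ.* 1) ≡ suc (N ℕ.* suc N ℕ.* 4)
  expand = solve-∀

-- Integer division of a negative number rounds downwards and commutes with negation only when the
-- remainder is zero.
-m/ℕd : ∀ m d .{{_ : ℕ.NonZero d}} → m ℕ.% d ≡ 0 → (ℤ.- (+ m)) ℤ./ℕ d ≡ ℤ.- (+ (m ℕ./ d))
-m/ℕd zero    d _     = ≡.trans (≡.cong +_ (ℕ.0/n≡0 d)) (≡.cong (λ k → ℤ.- (+ k)) (≡.sym (ℕ.0/n≡0 d)))
-m/ℕd (suc m) d m%d≡0 with suc m ℕ.% d
-m/ℕd (suc m) d ≡.refl | zero = ≡.refl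

exponent : ∀ N → (1ℤ ℤ.- (+ suc (N ℕ.* 2)) ℤ.^ 2) ℤ./ (+ 8) ≡ ℤ.- (+ triangular N)
exponent N = begin
  (1ℤ ℤ.- (+ n) ℤ.^ 2) ℤ./ (+ 8)                ≡⟨ ≡.cong (λ i → (1ℤ ℤ.- i) ℤ./ (+ 8)) n²≡ ⟩
  (1ℤ ℤ.- (+ suc (T ℕ.* 8))) ℤ./ (+ 8)
    ≡⟨ ≡.cong (ℤ._/ (+ 8)) (ℤ.⊖-≤ {1} {suc (T ℕ.* 8)} (ℕ.s≤s ℕ.z≤n)) ⟩
  -- The factor `1ℤ` is the sign of the divisor 8, from the definition of integer division.
  1ℤ ℤ.* ((ℤ.- (+ (T ℕ.* 8))) ℤ./ℕ 8)           ≡⟨ ℤ.*-identityˡ _ ⟩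
  (ℤ.- (+ (T ℕ.* 8))) ℤ./ℕ 8                    ≡⟨ -m/ℕd (T ℕ.* 8) 8 (ℕ.m*n%n≡0 T 8) ⟩
  ℤ.- (+ (T ℕ.* 8 ℕ./ 8))                       ≡⟨ ≡.cong (λ k → ℤ.- (+ k)) (ℕ.m*n/n≡m T 8) ⟩
  ℤ.- (+ T)                                     ∎
  where
  open ≡.≡-Reasoning
  n = suc (N ℕ.* 2)
  T = triangular N
  n²≡ : (+ n) ℤ.^ 2 ≡ + suc (T ℕ.* 8)
  n²≡ = begin
    + n ℤ.* (+ n ℤ.* 1ℤ)    ≡⟨ ≡.cong (+ n ℤ.*_) (ℤ.pos-* n 1) ⟨
    + n ℤ.* + (n ℕ.* 1)     ≡⟨ ℤ.pos-* n (n ℕ.* 1) ⟨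
    + (n ℕ.* (n ℕ.* 1))     ≡⟨ ≡.cong +_ ([1+2N]² N) ⟩
    + suc (T ℕ.* 8)         ∎

open ≡ using (refl)

theorem1p2 : (n : ℕ) → n ℕ.% 2 ≡ 1 →
    (∑[ k ≤ (n ℕ.∸ 1) ℕ./ 2 ]
    q ^ (k ℕ.^ 2) *
    (P.⟨ P.X ⨾ P.X P.^ 2 ⟩ k / P.⟨ P.X P.^ 4 ⨾ P.X P.^ 4 ⟩ k
    [ P.⟨⨾⟩-≉0 (P.X P.^ 4) (P.X P.^ 4) refl k ]))
    ≡ (- q) ^ℤ ((1ℤ ℤ.- (+ n) ℤ.^ 2) ℤ./ (+ 8)) [ -q≉0 ]
    [mod Φ n P.^ 2 ]
theorem1p2 n n%2≡1 = ≡.subst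
  (λ e → (∑[ k ≤ N ] summand (Φ n) N n≡1+2N Φ∣qⁿ-1 Φ-coprime k) ≡ (- q) ^ℤ e [ -q≉0 ] [mod Φ n P.^ 2 ])
  (≡.sym (≡.trans (≡.cong (λ m → (1ℤ ℤ.- (+ m) ℤ.^ 2) ℤ./ (+ 8)) n≡1+2N) (exponent N)))
  (congruence (Φ n) N n≡1+2N Φ∣qⁿ-1 Φ-coprime)
  where
  N = (n ℕ.∸ 1) ℕ./ 2
  n≡1+2[n/2] : n ≡ suc (n ℕ./ 2 ℕ.* 2)
  n≡1+2[n/2] = ≡.trans (ℕ.m≡m%n+[m/n]*n n 2) (≡.cong (ℕ._+ n ℕ./ 2 ℕ.* 2) n%2≡1)
  -- For odd n the truncated subtraction of 1 removes exactly the remainder modulo 2.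
  N≡n/2 : N ≡ n ℕ./ 2
  N≡n/2 = ≡.trans (≡.cong (λ m → (m ℕ.∸ 1) ℕ./ 2) n≡1+2[n/2]) (ℕ.m*n/n≡m (n ℕ./ 2) 2)
  n≡1+2N : n ≡ suc (N ℕ.* 2)
  n≡1+2N = ≡.trans n≡1+2[n/2] (≡.cong (λ m → suc (m ℕ.* 2)) (≡.sym N≡n/2))
  0<n : 0 ℕ.< n
  0<n = ≡.subst (0 ℕ.<_) (≡.sym n≡1+2N) ℕ.z<s
  Φ∣qⁿ-1 : Φ n ∣ qⁿ-1 n
  Φ∣qⁿ-1 = Cyclotomic.Φ∣qⁿ-1 (cyclotomic n 0<n)
  Φ-coprime : ∀ {m} → ¬ n ℕ.∣ m → Comaximal (Φ n) (qⁿ-1 m)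
  Φ-coprime = Φ-comaximal 0<n
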